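{- Let $i\ge 3$ and $k\ge 3$ be integers. Then: (a) $g_3(F_i,F_{i+2},F_{i+k})=(4F_i-1)F_{i+2}-F_i$ whenever $k\ge i+3$; (b) $g_3(F_i,F_{i+2},F_{2i+2})=(F_i-1)F_{i+2}+F_{2i+2}-F_i$; (c) $g_3(F_i,F_{i+2},F_{2i+1})=(F_i+F_{i-2}-1)F_{i+2}+F_{2i+1}-F_i$; (d) $g_3(F_i,F_{i+2},F_{2i})=(F_i-1)F_{i+2}+2F_{2i}-F_i$; (e) $g_3(F_i,F_{i+2},F_{2i-1})=(F_{i-2}-1)F_{i+2}+3F_{2i-1}-F_i$ for $i\ge 4$; (f) $g_3(F_i,F_{i+2},F_{2i-2})=(F_{i-5}-1)F_{i+2}+5F_{2i-2}-F_i$ for $i\ge 6$, and $g_3(F_5,F_7,F_8)=F_7+4F_8-F_5=92$; (g) if $r=\lfloor (F_i-1)/F_k\rfloor\ge 3$ (equivalently $k\le i-3$), then $$g_3(F_i,F_{i+2},F_{i+k})=\begin{cases}(F_i-rF_k-1)F_{i+2}+(r+3)F_{i+k}-F_i & \text{if } (F_i-rF_k)F_{i+2}\ge F_{k-2}F_i,\\ (F_k-1)F_{i+2}+(r+2)F_{i+k}-F_i & \text{if } (F_i-rF_k)F_{i+2}< F_{k-2}F_i.\end{cases}$$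
   Context: Fibonacci numbers: $F_0=0$, $F_1=1$, $F_n=F_{n-1}+F_{n-2}$. For positive integers $a_1,\dots,a_l$ with $\gcd(a_1,\dots,a_l)=1$ and an integer $n$, let $d(n;a_1,\dots,a_l)$ be the number of tuples $(x_1,\dots,x_l)$ of nonnegative integers with $a_1x_1+\dots+a_lx_l=n$. For a nonnegative integer $p$, the $p$-Frobenius number $g_p(a_1,\dots,a_l)$ is the largest integer $n$ with $d(n;a_1,\dots,a_l)\le p$. -}

module Defs where

open import Axiom.UniquenessOfIdentityProofs using (module Decidable⇒UIP)
open import Data.Fin.Base using (Fin)
open import Data.Integer.Base using (ℤ; +_; ∣_∣)
import Data.Integer.Base as ℤ
import Data.Integer.Properties as ℤ
open import Data.List.Base as List using (List; cartesianProductWith; filter; length; lookup; upTo)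
open import Data.List.Membership.Propositional using (_∈_)
open import Data.List.Membership.Propositional.Properties
  using (∈-cartesianProductWith⁺; ∈-filter⁺; ∈-filter⁻; ∈-lookup; ∈-upTo⁺)
open import Data.List.Relation.Unary.All as ListAll using ()
open import Data.List.Relation.Unary.AllPairs using ([]; _∷_)
open import Data.List.Relation.Unary.Any using (here; index)
open import Data.List.Relation.Unary.Any.Properties using (lookup-index)
open import Data.List.Relation.Unary.Unique.Propositional using (Unique)
open import Data.List.Relation.Unary.Unique.Propositional.Properties
  using (cartesianProductWith⁺; filter⁺; upTo⁺)
open import Data.Nat.Base
open import Data.Nat.Properties
open import Data.Product.Base using (Σ; _×_; _,_; proj₁; proj₂)
open import Data.Vec.Base using (Vec; []; _∷_; sum; zipWith)
open import Data.Vec.Properties using (∷-injective)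
open import Data.Vec.Relation.Unary.All using (All; []; _∷_)
open import Function.Bundles using (_↔_; mk↔ₛ′)
open import Relation.Binary.PropositionalEquality
open import Relation.Nullary using (contradiction)

F : ℕ → ℕ
F 0             = 0
F 1             = 1
F (suc (suc n)) = F (suc n) + F n

F-nonZero : ∀ {m n} → m < n → NonZero (F n)
F-nonZero {n = 1}           _ = _
F-nonZero {n = suc (suc n)} _ =
  >-nonZero (<-≤-trans (>-nonZero⁻¹ (F (suc n)) {{F-nonZero {0} {suc n} z<s}}) (m≤m+n _ _))

infixl 7 _·_

_·_ : ∀ {l} → Vec ℕ l → Vec ℕ l → ℕ
a · x = sum (zipWith _*_ a x)

tuples≤ : ∀ l → ℕ → List (Vec ℕ l)
tuples≤ zero    b = List.[ [] ]
tuples≤ (suc l) b = cartesianProductWith _∷_ (upTo (suc b)) (tuples≤ l b)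

-- When the entries of a are positive, every solution x of a · x ≡ n has all its
-- entries at most n, so only finitely many tuples have to be searched; `d-counts`
-- below shows that none is missed or counted twice.  For negative n the count is 0.
solutions : ∀ {l} → ℤ → Vec ℕ l → List (Vec ℕ l)
solutions {l} n a = filter (λ x → + (a · x) ℤ.≟ n) (tuples≤ l ∣ n ∣)

d : ∀ {l} → ℤ → Vec ℕ l → ℕ
d n a = length (solutions n a)

-- The relation g_p(a) = n, intended for positive entries with gcd 1 (g_p is then
-- defined); n is an integer because g_p may be negative.
IsFrobeniusNumber : ∀ {l} → ℕ → Vec ℕ l → ℤ → Set
IsFrobeniusNumber p a n = d n a ≤ p × (∀ m → d m a ≤ p → m ℤ.≤ n)

IsFrobeniusNumber-unique : ∀ {l p m n} {a : Vec ℕ l} →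
  IsFrobeniusNumber p a m → IsFrobeniusNumber p a n → m ≡ n
IsFrobeniusNumber-unique (dm , max-m) (dn , max-n) =
  ℤ.≤-antisym (max-n _ dm) (max-m _ dn)

tuples≤-unique : ∀ l b → Unique (tuples≤ l b)
tuples≤-unique zero    b = ListAll.[] ∷ []
tuples≤-unique (suc l) b =
  cartesianProductWith⁺ _∷_ ∷-injective (upTo⁺ (suc b)) (tuples≤-unique l b)

∈-tuples≤ : ∀ {l b} (a x : Vec ℕ l) → All NonZero a → a · x ≤ b → x ∈ tuples≤ l b
∈-tuples≤ []       []       _            _ = here refl
∈-tuples≤ (a ∷ as) (x ∷ xs) (a≢0 ∷ as≢0) h =
  ∈-cartesianProductWith⁺ _∷_
    (∈-upTo⁺ (s≤s (≤-trans (m≤n*m x a {{a≢0}}) (≤-trans (m≤m+n _ _) h))))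
    (∈-tuples≤ as xs as≢0 (≤-trans (m≤n+m _ (a * x)) h))

∈-solutions : ∀ {l n} (a x : Vec ℕ l) → All NonZero a → + (a · x) ≡ n → x ∈ solutions n a
∈-solutions a x a≢0 refl =
  ∈-filter⁺ (λ y → + (a · y) ℤ.≟ + (a · x)) (∈-tuples≤ a x a≢0 ≤-refl) refl

private
  lookup-injective : ∀ {A : Set} {xs : List A} → Unique xs →
                     ∀ i j → lookup xs i ≡ lookup xs j → i ≡ j
  lookup-injective (_  ∷ _) Fin.zero    Fin.zero    _  = refl
  lookup-injective (x∉ ∷ _) Fin.zero    (Fin.suc j) eq =
    contradiction eq (ListAll.lookup x∉ (∈-lookup j))
  lookup-injective (x∉ ∷ _) (Fin.suc i) Fin.zero    eq =
    contradiction (sym eq) (ListAll.lookup x∉ (∈-lookup i))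
  lookup-injective (_  ∷ u) (Fin.suc i) (Fin.suc j) eq =
    cong Fin.suc (lookup-injective u i j eq)

d-counts : ∀ {l} (n : ℤ) (a : Vec ℕ l) → All NonZero a →
           Fin (d n a) ↔ Σ (Vec ℕ l) (λ x → + (a · x) ≡ n)
d-counts {l} n a a≢0 = mk↔ₛ′ to from to∘from from∘to
  where
  P? = λ x → + (a · x) ℤ.≟ n

  Σ-≡ : {s t : Σ (Vec ℕ l) (λ x → + (a · x) ≡ n)} → proj₁ s ≡ proj₁ t → s ≡ t
  Σ-≡ {x , p} {_ , q} refl = cong (x ,_) (Decidable⇒UIP.≡-irrelevant ℤ._≟_ p q)

  to : Fin (d n a) → Σ (Vec ℕ l) (λ x → + (a · x) ≡ n)
  to i = lookup (solutions n a) i ,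
         proj₂ (∈-filter⁻ P? {xs = tuples≤ l ∣ n ∣} (∈-lookup i))

  from : Σ (Vec ℕ l) (λ x → + (a · x) ≡ n) → Fin (d n a)
  from (x , eq) = index (∈-solutions a x a≢0 eq)

  to∘from : ∀ s → to (from s) ≡ s
  to∘from (x , eq) = Σ-≡ (sym (lookup-index (∈-solutions a x a≢0 eq)))

  from∘to : ∀ i → from (to i) ≡ i
  from∘to i = lookup-injective (filter⁺ P? (tuples≤-unique l ∣ n ∣)) _ _
                (cong proj₁ (to∘from (to i)))

{-# OPTIONS --safe #-}
module Submission where

-- Write a = F i, b = F (i + 2), c = F (i + k), K = F k and K′ = F (k - 2), so that
-- c = K b - K′ a.  The representations of numbers congruent to b t modulo a (t < a)
-- are given by the pairs (y , z) with y + K z = t + a q for some q, and the number of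
-- representations of m in that class is the number of such pairs whose value
-- b y + c z = b t + a (b q - K′ z) is at most m.  Hence g₃ + a is the maximum over t of
-- the fourth smallest value in the class of t.  Each case has an extremal pair
-- (y* , z*) with y* < K: four pairs of value at most b y* + c z* exist in every class,
-- while in the class of (y* , z*) only three pairs have a smaller q, and 2 K′ ≤ K makes
-- the value at least b y* + c z* for all the others.  Throughout, Y stands for y* + 1.

open import Defs

-- The values of a class are never sorted. For fixed `q` the value falls by `a K′` with each unit of
-- `z`, while a step from `q` to `q + 1` adds `a b`. Such a step leaves room for only about `a / K`
-- further units of `z`, so by `2 K′ ≤ K` and `a ≤ b` it can save only about half of what it costs:
-- levels of larger `q` do not undercut the extremal pair. Rounding spoils this estimate when `z`
-- exceeds `z*` by exactly one, which needs an inequality of its own. The case distinction reflects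
-- how many values of `z` fit on one level. For large `K` the four pairs spread over several levels;
-- for small `K` they crowd onto one or two. Using `Y` in place of `y*` turns the comparisons into
-- strict ones such as `y < Y`, which is the form in which `t < a` and remainders deliver them.

module ThreeFibonacciGenerators where

  open import Axiom.UniquenessOfIdentityProofs using (module Decidable⇒UIP)
  open import Data.Fin.Base using (Fin)
  open import Data.Fin.Properties using (injective⇒≤)
  open import Data.Integer.Base as ℤ using (ℤ; +_; -[1+_])
  import Data.Integer.Properties as ℤ
  import Data.Integer.Tactic.RingSolver as ℤSolver
  open import Data.List.Base using () renaming ([] to []ˡ; _∷_ to _∷ˡ_)
  open import Data.Nat.Base hiding (_/_)
  open import Data.Nat.Coprimality as Coprimality
    using (Coprime; 1-coprimeTo; coprime-+; coprime-Bézout; coprime-divisor)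
  open import Data.Nat.Divisibility using (_∣_; divides; m∣m*n; ∣m+n∣m⇒∣n)
  open import Data.Nat.DivMod
    using (_/_; _%_; m≡m%n+[m/n]*n; m%n<n; m/n*n≤m; /-monoˡ-≤; m*n/n≡m)
  open import Data.Nat.GCD using (module Bézout)
  open import Data.Nat.Properties
  open import Data.Nat.Tactic.RingSolver using (solve)
  open import Data.Product using (Σ; ∃; ∃₂; _×_; _,_; proj₁; proj₂)
  open import Data.Product.Properties using (≡-dec)
  open import Data.Sum.Base using (inj₁; inj₂)
  open import Data.Vec.Base using (Vec; []; _∷_; lookup)
  open import Data.Vec.Properties using (∷-injective)
  open import Data.Vec.Relation.Unary.All using (All; []; _∷_)
  open import Data.Vec.Relation.Unary.All.Properties using (lookup⁺)
  open import Data.Vec.Relation.Unary.AllPairs using ([]; _∷_; allPairs?)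
  open import Data.Vec.Relation.Unary.Unique.Propositional using (Unique)
  open import Data.Vec.Relation.Unary.Unique.Propositional.Properties using (lookup-injective)
  open import Function.Base using (_∘_)
  open import Function.Bundles using (Inverse; _⇔_; mk⇔)
  open import Relation.Binary.PropositionalEquality
  open import Relation.Nullary using (contradiction)
  open import Relation.Nullary.Decidable using (Dec; ¬?; True; toWitness)

  -- Counting representations

  module _ {l : ℕ} {a : Vec ℕ l} (a≢0 : All NonZero a) (m k : ℕ) where
    open Inverse (d-counts (+ m) a a≢0)

    d-≥ : (f : Fin k → Vec ℕ l) → (∀ i → a · f i ≡ m) → (∀ {i j} → f i ≡ f j → i ≡ j) →
          k ≤ d (+ m) a
    d-≥ f f-solves f-injective = injective⇒≤ {f = λ i → from (sol i)} λ {i} {j} eq →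
      f-injective (cong proj₁ (trans (sym (strictlyInverseˡ (sol i)))
                                     (trans (cong to eq) (strictlyInverseˡ (sol j)))))
      where
      sol : Fin k → Σ (Vec ℕ l) λ x → + (a · x) ≡ + m
      sol i = f i , cong +_ (f-solves i)

    -- The labelling is a relation because the label of a solution comes out of an existence proof;
    -- no two solutions share a label.
    d-≤ : (R : Fin k → Vec ℕ l → Set) → (∀ x → a · x ≡ m → ∃ λ i → R i x) →
          (∀ {i x y} → a · x ≡ m → a · y ≡ m → R i x → R i y → x ≡ y) → d (+ m) a ≤ k
    d-≤ R total functional = injective⇒≤ {f = label} λ {i} {j} eq →
      to-injective i j (functional (solves i) (solves j)
        (subst (λ e → R e _) eq (labelled i)) (labelled j))
      where
      solves : ∀ i → a · proj₁ (to i) ≡ m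
      solves i = ℤ.+-injective (proj₂ (to i))
      label : Fin (d (+ m) a) → Fin k
      label i = proj₁ (total _ (solves i))
      labelled : ∀ i → R (label i) (proj₁ (to i))
      labelled i = proj₂ (total _ (solves i))
      Σ-≡ : {s t : Σ (Vec ℕ l) λ x → + (a · x) ≡ + m} → proj₁ s ≡ proj₁ t → s ≡ t
      Σ-≡ {x , p} {_ , q} refl = cong (x ,_) (Decidable⇒UIP.≡-irrelevant ℤ._≟_ p q)
      to-injective : ∀ i j → proj₁ (to i) ≡ proj₁ (to j) → i ≡ j
      to-injective i j eq =
        trans (sym (strictlyInverseʳ i)) (trans (cong from (Σ-≡ {to i} {to j} eq)) (strictlyInverseʳ j))

  -- Congruences without subtraction

  inverse-mod : ∀ {a b} → Coprime a b → ∃ λ x → ∃₂ λ u v → b * x + a * u ≡ 1 + a * v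
  inverse-mod {a} {b} coprime with coprime-Bézout coprime
  ... | Bézout.-+ x y eq = y , 0 , x , (begin
    b * y + a * 0  ≡⟨ solve (a ∷ˡ b ∷ˡ y ∷ˡ []ˡ) ⟩
    y * b          ≡⟨ eq ⟨
    1 + x * a      ≡⟨ cong suc (*-comm x a) ⟩
    1 + a * x      ∎)
    where open ≡-Reasoning
  ... | Bézout.+- x y eq = y * y * b , 2 * x , x * x * a , (begin
    -- If y b ≡ −1 then y² b is the inverse.
    b * (y * y * b) + a * (2 * x)     ≡⟨ solve (a ∷ˡ b ∷ˡ x ∷ˡ y ∷ˡ []ˡ) ⟩
    y * b * (y * b) + 2 * (x * a)     ≡⟨ cong (λ s → y * b * (y * b) + 2 * s) eq ⟨
    y * b * (y * b) + 2 * (1 + y * b) ≡⟨ solve (b ∷ˡ y ∷ˡ []ˡ) ⟩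
    1 + (1 + y * b) * (1 + y * b)     ≡⟨ cong (λ s → 1 + s * s) eq ⟩
    1 + x * a * (x * a)               ≡⟨ solve (a ∷ˡ x ∷ˡ []ˡ) ⟩
    1 + a * (x * x * a)               ∎)
    where open ≡-Reasoning

  -- Congruent numbers differ by a multiple of `a`, so `k < m + a` already forces `k ≤ m`. This is
  -- why values up to `g₃ + a` count, rather than up to `g₃`.
  ∃-multiple : ∀ a {k m p q} → k + a * p ≡ m + a * q → k < m + a → ∃ λ x → a * x + k ≡ m
  ∃-multiple a {k} {m} {p} {q} eq k<m+a with ≤-<-connex q p
  ... | inj₁ q≤p with x , refl ← m≤n⇒∃[o]m+o≡n q≤p = x , +-cancelʳ-≡ (a * q) _ _ (begin
    a * x + k + a * q  ≡⟨ solve (a ∷ˡ x ∷ˡ k ∷ˡ q ∷ˡ []ˡ) ⟩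
    k + a * (q + x)    ≡⟨ eq ⟩
    m + a * q          ∎)
    where open ≡-Reasoning
  ... | inj₂ p<q with e , refl ← m≤n⇒∃[o]m+o≡n p<q = contradiction k<m+a (≤⇒≯ (begin
    m + a          ≤⟨ m≤m+n (m + a) (a * e) ⟩
    m + a + a * e  ≡⟨ +-cancelʳ-≡ (a * p) _ _ (trans shift (sym eq)) ⟩
    k              ∎))
    where
    open ≤-Reasoning
    shift : m + a + a * e + a * p ≡ m + a * (1 + p + e)
    shift = solve (m ∷ˡ a ∷ˡ e ∷ˡ p ∷ˡ []ˡ)

  -- With K the residue of c / b modulo a, the pair (q , z) stands for the pair (y , z)
  -- with y + K z = t + a q, hence for a representation of numbers congruent to b t
  -- modulo a.
  Reaches : (a b c K bound t : ℕ) → ℕ × ℕ → Set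
  Reaches a b c K bound t (q , z) = ∃ λ y → y + K * z ≡ t + a * q × b * suc y + c * z ≤ bound

  FourBelow : (a b c K bound t : ℕ) → Set
  FourBelow a b c K bound t =
    ∃ λ (ps : Vec (ℕ × ℕ) 4) → Unique ps × All (Reaches a b c K bound t) ps

  -- The possible sets of three pairs below the extremal one. Unlike in `Reaches`, `q` counts
  -- downwards from the level of `(Y , Z)`, with 0 for the first level below it. The names give the
  -- number of pairs on successive levels.
  table-1-1-1 table-2-1 table-3 : Vec (ℕ × ℕ) 3
  table-1-1-1 = (0 , 0) ∷ (1 , 0) ∷ (2 , 0) ∷ []
  table-2-1   = (0 , 0) ∷ (0 , 1) ∷ (1 , 0) ∷ []
  table-3     = (0 , 0) ∷ (0 , 1) ∷ (0 , 2) ∷ []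

  -- The criterion: four pairs in every class, three below the extremal pair

  module ThreeGenerators
    {a b c K K′ : ℕ} .{{_ : NonZero a}} .{{_ : NonZero b}} .{{_ : NonZero c}} .{{_ : NonZero K}}
    (coprime : Coprime a b) (relation : c + a * K′ ≡ b * K)
    where

    private
      gens : Vec ℕ 3
      gens = a ∷ b ∷ c ∷ []

      gens≢0 : All NonZero gens
      gens≢0 = recover ∷ recover ∷ recover ∷ []
        where
        -- The module parameters are irrelevant, but `All` stores relevant proofs.
        recover : ∀ {n} .{{_ : NonZero n}} → NonZero n
        recover {suc _} = _

    value : ∀ y z → b * y + c * z + a * (K′ * z) ≡ b * (y + K * z)
    value y z = begin
      b * y + c * z + a * (K′ * z)  ≡⟨ solve (a ∷ˡ b ∷ˡ c ∷ˡ K′ ∷ˡ y ∷ˡ z ∷ˡ []ˡ) ⟩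
      b * y + (c + a * K′) * z      ≡⟨ cong (λ s → b * y + s * z) relation ⟩
      b * y + b * K * z             ≡⟨ solve (b ∷ˡ K ∷ˡ y ∷ˡ z ∷ˡ []ˡ) ⟩
      b * (y + K * z)               ∎
      where open ≡-Reasoning

    -- Rids an inequality of c = K b − K′ a without subtracting.
    cleared : ∀ D J → b * D + a * K′ * J ≤ b * K * J → b * D ≤ c * J
    cleared D J le = +-cancelʳ-≤ (a * K′ * J) _ _ (begin
      b * D + a * K′ * J  ≤⟨ le ⟩
      b * K * J           ≡⟨ cong (_* J) relation ⟨
      (c + a * K′) * J    ≡⟨ *-distribʳ-+ J c (a * K′) ⟩
      c * J + a * K′ * J  ∎)
      where open ≤-Reasoning

    module _ (a≤b : a ≤ b) (2K′≤K : 2 * K′ ≤ K) where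
      -- The subtracted term `a K′` is at most half of `b K`, and `c` is what remains.
      aK′≤c : a * K′ ≤ c
      aK′≤c = +-cancelʳ-≤ (a * K′) _ _ (begin
        a * K′ + a * K′  ≡⟨ solve (a ∷ˡ K′ ∷ˡ []ˡ) ⟩
        a * (2 * K′)     ≤⟨ *-mono-≤ a≤b 2K′≤K ⟩
        b * K            ≡⟨ relation ⟨
        c + a * K′       ∎)
        where open ≤-Reasoning

      bK≤2c : b * K ≤ c * 2
      bK≤2c = begin
        b * K            ≡⟨ relation ⟨
        c + a * K′       ≤⟨ +-monoʳ-≤ c aK′≤c ⟩
        c + c            ≡⟨ solve (c ∷ˡ []ˡ) ⟩
        c * 2            ∎
        where open ≤-Reasoning

    -- The summand `a` leads from `g₃` to the greatest value of a pair, and `b` accounts for `suc y`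
    -- in place of `y`.
    module _ {B n : ℕ} (n≡ : n + a + b ≡ B) where

      module _ {m t u v : ℕ} (n<m : n < m) (t≡ : b * t + a * u ≡ m + a * v) where
        private
          coefficient : ∀ {q z y} → y + K * z ≡ t + a * q → b * suc y + c * z ≤ B →
                        ∃ λ x → gens · (x ∷ y ∷ z ∷ []) ≡ m
          coefficient {q} {z} {y} y≡ y≤ =
            let x , x≡ = ∃-multiple a congruent below
            in x , trans (regroup x) x≡
            where
            regroup : ∀ x → a * x + (b * y + (c * z + 0)) ≡ a * x + (b * y + c * z)
            regroup x = solve (a ∷ˡ b ∷ˡ c ∷ˡ x ∷ˡ y ∷ˡ z ∷ˡ []ˡ)
            congruent : b * y + c * z + a * (K′ * z + u) ≡ m + a * (b * q + v)
            congruent = begin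
              b * y + c * z + a * (K′ * z + u)        ≡⟨ solve (a ∷ˡ b ∷ˡ c ∷ˡ K′ ∷ˡ u ∷ˡ y ∷ˡ z ∷ˡ []ˡ) ⟩
              b * y + c * z + a * (K′ * z) + a * u    ≡⟨ cong (_+ a * u) (value y z) ⟩
              b * (y + K * z) + a * u                 ≡⟨ cong (λ s → b * s + a * u) y≡ ⟩
              b * (t + a * q) + a * u                 ≡⟨ solve (a ∷ˡ b ∷ˡ q ∷ˡ t ∷ˡ u ∷ˡ []ˡ) ⟩
              b * t + a * u + a * (b * q)             ≡⟨ cong (_+ a * (b * q)) t≡ ⟩
              m + a * v + a * (b * q)                 ≡⟨ solve (a ∷ˡ b ∷ˡ m ∷ˡ q ∷ˡ v ∷ˡ []ˡ) ⟩
              m + a * (b * q + v)                     ∎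
              where open ≡-Reasoning
            below : b * y + c * z < m + a
            below = +-cancelʳ-< b _ _ (begin-strict
              b * y + c * z + b    ≡⟨ solve (b ∷ˡ c ∷ˡ y ∷ˡ z ∷ˡ []ˡ) ⟩
              b * (1 + y) + c * z  ≤⟨ y≤ ⟩
              B                    ≡⟨ n≡ ⟨
              n + a + b            <⟨ +-monoˡ-< b (+-monoˡ-< a n<m) ⟩
              m + a + b            ∎)
              where open ≤-Reasoning

          pair-injective : ∀ {y q z y′ q′ z′} → y + K * z ≡ t + a * q → y′ + K * z′ ≡ t + a * q′ →
                           y ≡ y′ → z ≡ z′ → (q , z) ≡ (q′ , z′)
          pair-injective {q = q} {z} {q′ = q′} y≡ y≡′ refl refl =
            cong (_, z) (*-cancelˡ-≡ q q′ a (+-cancelˡ-≡ t _ _ (trans (sym y≡) y≡′)))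

        four-solutions : FourBelow a b c K B t → 4 ≤ d (+ m) gens
        four-solutions (ps , unique , below) = d-≥ gens≢0 m 4
          (λ i → X i ∷ Y i ∷ proj₂ (lookup ps i) ∷ [])
          (λ i → proj₂ (coefficient (y≡ i) (y≤ i)))
          (λ {i} {j} eq → let yz≡ = proj₂ (∷-injective eq) in
            lookup-injective unique i j (pair-injective (y≡ i) (y≡ j)
              (proj₁ (∷-injective yz≡)) (proj₁ (∷-injective (proj₂ (∷-injective yz≡))))))
          where
          Y : Fin 4 → ℕ
          Y i = proj₁ (lookup⁺ below i)
          y≡ : ∀ i → _
          y≡ i = proj₁ (proj₂ (lookup⁺ below i))
          y≤ : ∀ i → _
          y≤ i = proj₂ (proj₂ (lookup⁺ below i))
          X : Fin 4 → ℕ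
          X i = proj₁ (coefficient (y≡ i) (y≤ i))

      at-least-four : (∀ t → t < a → FourBelow a b c K B t) → ∀ m → n < m → 4 ≤ d (+ m) gens
      at-least-four four m n<m with x , u , v , bx≡ ← inverse-mod coprime =
        -- As `x` inverts `b` modulo `a`, the remainder `t` of `x m` satisfies `b t ≡ m`.
        four-solutions {t = t} {u = b * (x * m / a) + u * m} {v = v * m} n<m (begin
          b * t + a * (b * (x * m / a) + u * m)  ≡⟨ lemma t (x * m / a) ⟩
          b * (t + x * m / a * a) + a * u * m    ≡⟨ cong (λ s → b * s + a * u * m) (m≡m%n+[m/n]*n (x * m) a) ⟨
          b * (x * m) + a * u * m                ≡⟨ solve (a ∷ˡ b ∷ˡ x ∷ˡ m ∷ˡ u ∷ˡ []ˡ) ⟩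
          (b * x + a * u) * m                    ≡⟨ cong (_* m) bx≡ ⟩
          (1 + a * v) * m                        ≡⟨ solve (a ∷ˡ m ∷ˡ v ∷ˡ []ˡ) ⟩
          m + a * (v * m)                        ∎)
          (four t (m%n<n (x * m) a))
        where
        open ≡-Reasoning
        t : ℕ
        t = x * m % a
        lemma : ∀ t e → b * t + a * (b * e + u * m) ≡ b * (t + e * a) + a * u * m
        lemma t e = solve (a ∷ˡ b ∷ˡ m ∷ˡ t ∷ˡ u ∷ˡ e ∷ˡ []ˡ)

      module _ {Y Z : ℕ} (B≡ : B ≡ b * Y + c * Z)
        (above : ∀ y z q → suc y + K * z ≡ Y + K * Z + a * q → B ≤ b * suc y + c * z)
        (table : Vec (ℕ × ℕ) 3)
        (complete : ∀ y z q → suc y + K * z + a * suc q ≡ Y + K * Z → ∃ λ i → lookup table i ≡ (q , z))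
        where
        private
          ∣-difference : ∀ {w δ p q} → b * (w + δ) + a * p ≡ b * w + a * q → a ∣ δ
          ∣-difference {w} {δ} {p} {q} eq =
            coprime-divisor coprime (∣m+n∣m⇒∣n (subst (a ∣_) (sym eq′) (m∣m*n q)) (m∣m*n p))
            where
            eq′ : a * p + b * δ ≡ a * q
            eq′ = +-cancelˡ-≡ (b * w) _ _ (trans regroup eq)
              where
              regroup : b * w + (a * p + b * δ) ≡ b * (w + δ) + a * p
              regroup = solve (a ∷ˡ b ∷ˡ p ∷ˡ w ∷ˡ δ ∷ˡ []ˡ)

          -- Coprimality of `a` and `b` turns the congruence of the values into one of `suc y + K z`
          -- and `Y + K Z`. At or above the level of `(Y , Z)`, the inequality `above` leaves no
          -- room for the positive term `a * suc x`.
          level : ∀ {x y z} → gens · (x ∷ y ∷ z ∷ []) ≡ n →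
                  ∃ λ q → suc y + K * z + a * suc q ≡ Y + K * Z
          level {x} {y} {z} eq = by-cases (≤-<-connex (Y + K * Z) (suc y + K * z))
            where
            total : b * suc y + c * z + a * suc x ≡ B
            total = begin
              b * (1 + y) + c * z + a * (1 + x)        ≡⟨ solve (a ∷ˡ b ∷ˡ c ∷ˡ x ∷ˡ y ∷ˡ z ∷ˡ []ˡ) ⟩
              a * x + (b * y + (c * z + 0)) + a + b    ≡⟨ cong (λ s → s + a + b) eq ⟩
              n + a + b                                ≡⟨ n≡ ⟩
              B                                        ∎
              where open ≡-Reasoning

            balance : b * (suc y + K * z) + a * (suc x + K′ * Z) ≡ b * (Y + K * Z) + a * (K′ * z)
            balance = begin
              b * (suc y + K * z) + a * (suc x + K′ * Z)
                ≡⟨ cong (_+ a * (suc x + K′ * Z)) (value (suc y) z) ⟨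
              b * (1 + y) + c * z + a * (K′ * z) + a * (1 + x + K′ * Z)
                ≡⟨ solve (a ∷ˡ b ∷ˡ c ∷ˡ K′ ∷ˡ x ∷ˡ y ∷ˡ z ∷ˡ Z ∷ˡ []ˡ) ⟩
              b * (1 + y) + c * z + a * (1 + x) + a * (K′ * Z) + a * (K′ * z)
                ≡⟨ cong (λ s → s + a * (K′ * Z) + a * (K′ * z)) (trans total B≡) ⟩
              b * Y + c * Z + a * (K′ * Z) + a * (K′ * z)
                ≡⟨ cong (_+ a * (K′ * z)) (value Y Z) ⟩
              b * (Y + K * Z) + a * (K′ * z) ∎
              where open ≡-Reasoning

            by-cases : _ → ∃ λ q → suc y + K * z + a * suc q ≡ Y + K * Z
            by-cases (inj₁ W≤u) with δ , W+δ≡u ← m≤n⇒∃[o]m+o≡n W≤u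
              with divides q δ≡ ← ∣-difference {Y + K * Z} {δ}
                     (subst (λ s → b * s + a * (suc x + K′ * Z) ≡ b * (Y + K * Z) + a * (K′ * z))
                            (sym W+δ≡u) balance) =
              contradiction (above y z q (trans (sym W+δ≡u)
                               (cong (λ s → Y + K * Z + s) (trans δ≡ (*-comm q a)))))
                            (<⇒≱ (<-≤-trans (m<m+n _ (*-mono-< (>-nonZero⁻¹ a) (s≤s z≤n))) (≤-reflexive total)))
            by-cases (inj₂ u<W) with e , suc-u+e≡W ← m≤n⇒∃[o]m+o≡n u<W
              with u+δ≡W ← trans (+-suc (suc y + K * z) e) suc-u+e≡W
              with ∣-difference {suc y + K * z} {suc e}
                     (subst (λ s → b * s + a * (K′ * z) ≡ b * (suc y + K * z) + a * (suc x + K′ * Z))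
                            (sym u+δ≡W) (sym balance))
            ... | divides (suc q) δ≡ =
              q , trans (cong (λ s → suc y + K * z + s) (trans (*-comm a (suc q)) (sym δ≡))) u+δ≡W

          Listed : Fin 3 → Vec ℕ 3 → Set
          Listed i (x ∷ y ∷ z ∷ []) = ∃ λ q → suc y + K * z + a * suc q ≡ Y + K * Z × lookup table i ≡ (q , z)

          listed : ∀ x → gens · x ≡ n → ∃ λ i → Listed i x
          listed (x ∷ y ∷ z ∷ []) eq =
            let q , y≡ = level eq
                i , i≡ = complete y z q y≡
            in i , q , y≡ , i≡

          -- The label gives `q` and `z`; these fix `y` through the level, and then `x` through the
          -- value.
          listed-injective : ∀ {i x x′} → gens · x ≡ n → gens · x′ ≡ n → Listed i x → Listed i x′ → x ≡ x′
          listed-injective {x = x ∷ y ∷ z ∷ []} {x′ ∷ y′ ∷ z′ ∷ []} eq eq′ (q , y≡ , i≡) (q′ , y≡′ , i≡′)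
            with refl ← trans (sym i≡) i≡′
            with refl ← +-cancelʳ-≡ (K * z) _ _ (+-cancelʳ-≡ (a * suc q) _ _ (trans y≡ (sym y≡′))) =
            cong (_∷ y ∷ z ∷ []) (*-cancelˡ-≡ x x′ a (+-cancelʳ-≡ _ _ _ (trans eq (sym eq′))))

        at-most-three : d (+ n) gens ≤ 3
        at-most-three = d-≤ gens≢0 n 3 Listed listed listed-injective

    Complete : Vec (ℕ × ℕ) 3 → ℕ → Set
    Complete table w = ∀ y z q → suc y + K * z + a * suc q ≡ w → ∃ λ i → lookup table i ≡ (q , z)

    -- The hypothesis `K′ ≤ b * q` serves the pairs with `z = Z + 1`. The bound on `a + b` makes the
    -- claimed number nonnegative, so that the counting takes place in the natural numbers.
    frobenius : ∀ Y Z table → Y ≤ K → 2 * K′ ≤ K → a ≤ b →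
                (∀ q → 1 ≤ q → K ≤ Y + a * q → K′ ≤ b * q) →
                a + b ≤ b * Y + c * Z → Complete table (Y + K * Z) →
                (∀ t → t < a → FourBelow a b c K (b * Y + c * Z) t) →
                IsFrobeniusNumber 3 gens ((+ Y ℤ.- + 1) ℤ.* + b ℤ.+ + Z ℤ.* + c ℤ.- + a)
    frobenius Y Z table Y≤K 2K′≤K a≤b near a+b≤ complete four
      with n , n≡′ ← m≤n⇒∃[o]m+o≡n a+b≤ =
      subst (IsFrobeniusNumber 3 gens) (sym G≡)
        (at-most-three n≡ refl above table complete , maximal)
      where
      n≡ : n + a + b ≡ b * Y + c * Z
      n≡ = trans (trans (+-assoc n a b) (+-comm n (a + b))) n≡′

      G≡ : (+ Y ℤ.- + 1) ℤ.* + b ℤ.+ + Z ℤ.* + c ℤ.- + a ≡ + n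
      G≡ = begin
        (+ Y ℤ.- + 1) ℤ.* + b ℤ.+ + Z ℤ.* + c ℤ.- + a
          ≡⟨ rearrange (+ Y) (+ Z) (+ a) (+ b) (+ c) ⟩
        + b ℤ.* + Y ℤ.+ + c ℤ.* + Z ℤ.- + a ℤ.- + b
          ≡⟨ cong₂ (λ p q → p ℤ.+ q ℤ.- + a ℤ.- + b) (ℤ.pos-* b Y) (ℤ.pos-* c Z) ⟨
        + (b * Y + c * Z) ℤ.- + a ℤ.- + b
          ≡⟨ cong (λ p → + p ℤ.- + a ℤ.- + b) n≡ ⟨
        + n ℤ.+ + a ℤ.+ + b ℤ.- + a ℤ.- + b
          ≡⟨ cancel (+ n) (+ a) (+ b) ⟩
        + n ∎
        where
        open ≡-Reasoning
        rearrange : ∀ Y Z a b c → (Y ℤ.- + 1) ℤ.* b ℤ.+ Z ℤ.* c ℤ.- a ≡ b ℤ.* Y ℤ.+ c ℤ.* Z ℤ.- a ℤ.- b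
        rearrange = ℤSolver.solve-∀
        cancel : ∀ n a b → n ℤ.+ a ℤ.+ b ℤ.- a ℤ.- b ≡ n
        cancel = ℤSolver.solve-∀

      maximal : ∀ m → d m gens ≤ 3 → m ℤ.≤ + n
      maximal -[1+ m ] _ = ℤ.-≤+
      maximal (+ m) d≤3 =
        ℤ.+≤+ (≮⇒≥ λ n<m → contradiction (≤-trans (at-least-four n≡ four m n<m) d≤3) (<⇒≱ (n<1+n 3)))

      -- If z > Z then K (z − Z − 1) < a q, and 2 K′ ≤ K gains the factor needed to
      -- replace z − Z − 1 by z − Z, unless z = Z + 1.
      few : ∀ y z q → suc y + K * z ≡ Y + K * Z + a * q → K′ * z ≤ K′ * Z + b * q
      few y z q eq with ≤-<-connex z Z
      ... | inj₁ z≤Z = ≤-trans (*-monoʳ-≤ K′ z≤Z) (m≤m+n _ _)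
      ... | inj₂ Z<z with e , refl ← m≤n⇒∃[o]m+o≡n Z<z = begin
        K′ * suc (Z + e)      ≡⟨ cong (K′ *_) (+-suc Z e) ⟨
        K′ * (Z + suc e)      ≡⟨ *-distribˡ-+ K′ Z (suc e) ⟩
        K′ * Z + K′ * suc e   ≤⟨ +-monoʳ-≤ (K′ * Z) (step e excess) ⟩
        K′ * Z + b * q        ∎
        where
        open ≤-Reasoning
        excess : suc y + K * suc e ≡ Y + a * q
        excess = +-cancelʳ-≡ (K * Z) _ _ (begin-equality
          1 + y + K * (1 + e) + K * Z  ≡⟨ solve (y ∷ˡ K ∷ˡ e ∷ˡ Z ∷ˡ []ˡ) ⟩
          1 + y + K * (1 + Z + e)      ≡⟨ eq ⟩
          Y + K * Z + a * q            ≡⟨ solve (Y ∷ˡ K ∷ˡ Z ∷ˡ a ∷ˡ q ∷ˡ []ˡ) ⟩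
          Y + a * q + K * Z            ∎)
        step : ∀ e → suc y + K * suc e ≡ Y + a * q → K′ * suc e ≤ b * q
        step zero eq = begin
          K′ * 1  ≡⟨ *-identityʳ K′ ⟩
          K′      ≤⟨ near q 1≤q (≤-trans (m≤n+m K (suc y)) (≤-reflexive eq′)) ⟩
          b * q   ∎
          where
          eq′ : suc y + K ≡ Y + a * q
          eq′ = trans (cong (λ k → suc y + k) (sym (*-identityʳ K))) eq
          1≤q : 1 ≤ q
          1≤q = n≢0⇒n>0 λ q≡0 → <⇒≱ (<-≤-trans (m<n+m K (s≤s z≤n)) (≤-reflexive eq′)) (begin
            Y + a * q  ≡⟨ cong (λ s → Y + a * s) q≡0 ⟩
            Y + a * 0  ≡⟨ cong (λ s → Y + s) (*-zeroʳ a) ⟩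
            Y + 0      ≡⟨ +-identityʳ Y ⟩
            Y          ≤⟨ Y≤K ⟩
            K          ∎)
        step (suc e) eq = begin
          K′ * (2 + e)        ≤⟨ *-monoʳ-≤ K′ (m≤m+n (2 + e) e) ⟩
          K′ * (2 + e + e)    ≡⟨ solve (K′ ∷ˡ e ∷ˡ []ˡ) ⟩
          2 * K′ * (1 + e)    ≤⟨ *-monoˡ-≤ (suc e) 2K′≤K ⟩
          K * (1 + e)         ≤⟨ +-cancelˡ-≤ K _ _ below ⟩
          a * q               ≤⟨ *-monoˡ-≤ q a≤b ⟩
          b * q               ∎
          where
          below : K + K * (1 + e) ≤ K + a * q
          below = begin
            K + K * (1 + e)      ≡⟨ solve (K ∷ˡ e ∷ˡ []ˡ) ⟩
            K * (2 + e)          ≤⟨ m≤n+m _ (suc y) ⟩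
            suc y + K * (2 + e)  ≡⟨ eq ⟩
            Y + a * q            ≤⟨ +-monoˡ-≤ (a * q) Y≤K ⟩
            K + a * q            ∎

      -- Once `value` has removed `c`, this is `few` multiplied by `a`.
      above : ∀ y z q → suc y + K * z ≡ Y + K * Z + a * q → b * Y + c * Z ≤ b * suc y + c * z
      above y z q eq = +-cancelʳ-≤ (a * (K′ * z)) _ _ (begin
        b * Y + c * Z + a * (K′ * z)                ≤⟨ +-monoʳ-≤ (b * Y + c * Z) (*-monoʳ-≤ a (few y z q eq)) ⟩
        b * Y + c * Z + a * (K′ * Z + b * q)        ≡⟨ solve (a ∷ˡ b ∷ˡ c ∷ˡ K′ ∷ˡ Y ∷ˡ Z ∷ˡ q ∷ˡ []ˡ) ⟩
        b * Y + c * Z + a * (K′ * Z) + b * (a * q)  ≡⟨ cong (_+ b * (a * q)) (value Y Z) ⟩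
        b * (Y + K * Z) + b * (a * q)               ≡⟨ *-distribˡ-+ b (Y + K * Z) (a * q) ⟨
        b * (Y + K * Z + a * q)                     ≡⟨ cong (b *_) eq ⟨
        b * (suc y + K * z)                         ≡⟨ value (suc y) z ⟨
        b * suc y + c * z + a * (K′ * z)            ∎)
        where open ≤-Reasoning

    -- Pairs below the extremal level

    private
      q-bound : ∀ {w} N y z q → suc y + K * z + a * suc q ≡ w → w ≤ a * N → suc q < N
      q-bound {w} N y z q eq w≤ = *-cancelˡ-< a _ _ (begin-strict
        a * suc q                    <⟨ m<n+m _ (s≤s z≤n) ⟩
        suc y + K * z + a * suc q    ≡⟨ eq ⟩
        w                            ≤⟨ w≤ ⟩
        a * N                        ∎)
        where open ≤-Reasoning

      z-bound : ∀ {w} N y z q → suc y + K * z + a * suc q ≡ w → w ≤ K * N + a * suc q → z < N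
      z-bound {w} N y z q eq w≤ = *-cancelˡ-< K _ _ (begin-strict
        K * z          <⟨ m<n+m _ (s≤s z≤n) ⟩
        suc y + K * z  ≤⟨ +-cancelʳ-≤ (a * suc q) _ _ (≤-trans (≤-reflexive eq) w≤) ⟩
        K * N          ∎)
        where open ≤-Reasoning

    -- A bound `a * N` on `w` leaves `N − 1` levels, and a bound `K * N + a * s` leaves the values
    -- `z < N` on the `s`-th level below `w`. The hypotheses here and in the next two lemmas are
    -- read off the shape of the table.
    complete-1-1-1 : ∀ {w} → w ≤ a * 4 → w ≤ K * 1 + a * 1 →
                     Complete table-1-1-1 w
    complete-1-1-1 w≤4a w≤K+a y z q eq
      with q | q-bound 4 y z q eq w≤4a
         | z-bound 1 y z q eq (≤-trans w≤K+a (+-monoʳ-≤ (K * 1) (*-monoʳ-≤ a (s≤s z≤n))))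
    ... | 0 | _ | s≤s z≤n = Fin.zero , refl
    ... | 1 | _ | s≤s z≤n = Fin.suc Fin.zero , refl
    ... | 2 | _ | s≤s z≤n = Fin.suc (Fin.suc Fin.zero) , refl
    ... | suc (suc (suc _)) | s≤s (s≤s (s≤s (s≤s ()))) | _

    complete-2-1 : ∀ {w} → w ≤ a * 3 → w ≤ K * 2 + a * 1 → w ≤ K * 1 + a * 2 →
                   Complete table-2-1 w
    complete-2-1 w≤3a w≤2K+a w≤K+2a y z 0 eq with z | z-bound 2 y z 0 eq w≤2K+a
    ... | 0 | _ = Fin.zero , refl
    ... | 1 | _ = Fin.suc Fin.zero , refl
    ... | suc (suc _) | s≤s (s≤s ())
    complete-2-1 w≤3a w≤2K+a w≤K+2a y z 1 eq with z | z-bound 1 y z 1 eq w≤K+2a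
    ... | 0 | _ = Fin.suc (Fin.suc Fin.zero) , refl
    ... | suc _ | s≤s ()
    complete-2-1 w≤3a w≤2K+a w≤K+2a y z (suc (suc q)) eq with q-bound 3 y z (suc (suc q)) eq w≤3a
    ... | s≤s (s≤s (s≤s ()))

    complete-3 : ∀ {w} → w ≤ a * 2 → w ≤ K * 3 + a * 1 →
                 Complete table-3 w
    complete-3 w≤2a w≤3K+a y z 0 eq with z | z-bound 3 y z 0 eq w≤3K+a
    ... | 0 | _ = Fin.zero , refl
    ... | 1 | _ = Fin.suc Fin.zero , refl
    ... | 2 | _ = Fin.suc (Fin.suc Fin.zero) , refl
    ... | suc (suc (suc _)) | s≤s (s≤s (s≤s ()))
    complete-3 w≤2a w≤3K+a y z (suc q) eq with q-bound 2 y z (suc q) eq w≤2a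
    ... | s≤s (s≤s ())

  -- Four pairs of small value in every residue class

  unique? : ∀ {n} (ps : Vec (ℕ × ℕ) n) → Dec (Unique ps)
  unique? = allPairs? λ p q → ¬? (≡-dec _≟_ _≟_ p q)

  -- Up to `D` extra units of `y` are paid for by `J` units of `z`. Each case below rests on a few
  -- such rates `b D ≤ c J`.
  exchange : ∀ b c {y Y z} D J → y < Y + D → b * D ≤ c * J → b * suc y + c * z ≤ b * Y + c * (J + z)
  exchange b c {y} {Y} {z} D J y< bD≤cJ = begin
    b * suc y + c * z          ≤⟨ +-monoˡ-≤ (c * z) (*-monoʳ-≤ b y<) ⟩
    b * (Y + D) + c * z        ≡⟨ solve (b ∷ˡ c ∷ˡ Y ∷ˡ D ∷ˡ z ∷ˡ []ˡ) ⟩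
    b * Y + (b * D + c * z)    ≤⟨ +-monoʳ-≤ (b * Y) (+-monoˡ-≤ (c * z) bD≤cJ) ⟩
    b * Y + (c * J + c * z)    ≡⟨ cong (λ s → b * Y + s) (*-distribˡ-+ c J z) ⟨
    b * Y + c * (J + z)        ∎
    where open ≤-Reasoning

  dominated : ∀ b c {y Y z} J → y < Y → b * suc y + c * z ≤ b * Y + c * (J + z)
  dominated b c J y<Y =
    exchange b c 0 J (<-≤-trans y<Y (m≤m+n _ 0)) (≤-trans (≤-reflexive (*-zeroʳ b)) z≤n)

  literally-unique : ∀ {n} {ps : Vec (ℕ × ℕ) n} {_ : True (unique? ps)} → Unique ps
  literally-unique {_} {_} {unique} = toWitness unique

  -- One pair with `z = 0` on each of four levels: `t + a q` stays below `4 a`.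
  four-k≥i+3 : ∀ a {b c K} t → t < a → FourBelow a b c K (b * (4 * a) + c * 0) t
  four-k≥i+3 a {b} {c} {K} t t<a =
    (0 , 0) ∷ (1 , 0) ∷ (2 , 0) ∷ (3 , 0) ∷ [] , literally-unique ,
    column 0 (m≤m+n 1 3) ∷ column 1 (m≤m+n 2 2) ∷ column 2 (m≤m+n 3 1) ∷ column 3 ≤-refl ∷ []
    where
    open ≤-Reasoning
    column : ∀ q → q < 4 → Reaches a b c K (b * (4 * a) + c * 0) t (q , 0)
    column q q<4 = t + a * q , solve (t ∷ˡ a ∷ˡ q ∷ˡ K ∷ˡ []ˡ) , dominated b c 0 (begin-strict
      t + a * q  <⟨ +-monoˡ-< (a * q) t<a ⟩
      a + a * q  ≡⟨ solve (a ∷ˡ q ∷ˡ []ˡ) ⟩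
      suc q * a  ≤⟨ *-monoˡ-≤ a q<4 ⟩
      4 * a      ∎)

  -- Here `e` is `F (i − 1)`. Three pairs have `z = 0`; the fourth has `z = 1`, on the first level
  -- with `t + a q ≥ K`, which depends on whether `e ≤ t`.
  four-k=i+2 : ∀ a e {b c K} → K ≡ 2 * a + e → e ≤ a → b * (a * 2) ≤ c * 1 →
           ∀ t → t < a → FourBelow a b c K (b * a + c * 1) t
  four-k=i+2 a e {b} {c} refl e≤a key t t<a with ≤-<-connex e t
  ... | inj₁ e≤t with t′ , refl ← m≤n⇒∃[o]m+o≡n e≤t =
    (0 , 0) ∷ (1 , 0) ∷ (2 , 0) ∷ (2 , 1) ∷ [] , literally-unique ,
    column 0 z≤n ∷ column 1 (m≤m+n 1 1) ∷ column 2 ≤-refl ∷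
    (t′ , solve (t′ ∷ˡ a ∷ˡ e ∷ˡ []ˡ) , dominated b c 0 (≤-<-trans (m≤n+m t′ e) t<a)) ∷ []
    where
    column : ∀ q → q ≤ 2 → Reaches a b c (2 * a + e) (b * a + c * 1) (e + t′) (q , 0)
    column q q≤2 = e + t′ + a * q , solve (e ∷ˡ t′ ∷ˡ a ∷ˡ q ∷ˡ []ˡ) ,
      exchange b c (a * 2) 1 (+-mono-<-≤ t<a (*-monoʳ-≤ a q≤2)) key
  ... | inj₂ t<e with e′ , refl ← m≤n⇒∃[o]m+o≡n e≤a =
    (0 , 0) ∷ (1 , 0) ∷ (2 , 0) ∷ (3 , 1) ∷ [] , literally-unique ,
    column 0 z≤n ∷ column 1 (m≤m+n 1 1) ∷ column 2 ≤-refl ∷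
    (t + e′ , solve (t ∷ˡ e′ ∷ˡ e ∷ˡ []ˡ) , dominated b c 0 (+-monoˡ-< e′ t<e)) ∷ []
    where
    column : ∀ q → q ≤ 2 → Reaches (e + e′) b c (2 * (e + e′) + e) (b * (e + e′) + c * 1) t (q , 0)
    column q q≤2 = t + (e + e′) * q , solve (e ∷ˡ e′ ∷ˡ t ∷ˡ q ∷ˡ []ˡ) ,
      exchange b c ((e + e′) * 2) 1 (+-mono-<-≤ t<a (*-monoʳ-≤ (e + e′) q≤2)) key

  -- Here `e` and `f` are `F (i − 1)` and `F (i − 2)`. As `K = a + e`, the value `z = 1` occurs from
  -- level 1 on if `e ≤ t`, and from level 2 on otherwise.
  four-k=i+1 : ∀ e f {b c} → b * (2 * e) ≤ c * 1 →
           ∀ t → t < e + f → FourBelow (e + f) b c (e + f + e) (b * (e + f + f) + c * 1) t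
  four-k=i+1 e f {b} {c} key t t<a with ≤-<-connex e t
  ... | inj₁ e≤t with t′ , refl ← m≤n⇒∃[o]m+o≡n e≤t =
    (0 , 0) ∷ (1 , 0) ∷ (1 , 1) ∷ (2 , 1) ∷ [] , literally-unique ,
    (e + t′ , solve (t′ ∷ˡ e ∷ˡ f ∷ˡ []ˡ) , exchange b c (2 * e) 1 (<-≤-trans t<a e+f≤) key) ∷
    (e + t′ + (e + f) , solve (t′ ∷ˡ e ∷ˡ f ∷ˡ []ˡ) ,
      exchange b c (2 * e) 1 (<-≤-trans (+-monoˡ-< (e + f) t<a) 2a≤) key) ∷
    (t′ , solve (t′ ∷ˡ e ∷ˡ f ∷ˡ []ˡ) ,
      dominated b c 0 (<-≤-trans (≤-<-trans (m≤n+m t′ e) t<a) (m≤m+n (e + f) f))) ∷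
    (e + t′ + f , solve (t′ ∷ˡ e ∷ˡ f ∷ˡ []ˡ) , dominated b c 0 (+-monoˡ-< f t<a)) ∷ []
    where
    open ≤-Reasoning
    e+f≤ : e + f ≤ e + f + f + 2 * e
    e+f≤ = begin
      e + f                    ≤⟨ m≤m+n (e + f) (f + 2 * e) ⟩
      e + f + (f + 2 * e)      ≡⟨ solve (e ∷ˡ f ∷ˡ []ˡ) ⟩
      e + f + f + 2 * e        ∎
    2a≤ : e + f + (e + f) ≤ e + f + f + 2 * e
    2a≤ = begin
      e + f + (e + f)          ≤⟨ m≤m+n (e + f + (e + f)) e ⟩
      e + f + (e + f) + e      ≡⟨ solve (e ∷ˡ f ∷ˡ []ˡ) ⟩
      e + f + f + 2 * e        ∎
  ... | inj₂ t<e =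
    (0 , 0) ∷ (1 , 0) ∷ (2 , 0) ∷ (2 , 1) ∷ [] , literally-unique ,
    column 0 z≤n ∷ column 1 (m≤m+n 1 1) ∷ column 2 ≤-refl ∷
    (t + f , solve (t ∷ˡ e ∷ˡ f ∷ˡ []ˡ) , dominated b c 0 (+-monoˡ-< f t<a)) ∷ []
    where
    open ≤-Reasoning
    column : ∀ q → q ≤ 2 → Reaches (e + f) b c (e + f + e) (b * (e + f + f) + c * 1) t (q , 0)
    column q q≤2 = t + (e + f) * q , solve (e ∷ˡ f ∷ˡ t ∷ˡ q ∷ˡ []ˡ) ,
      exchange b c (2 * e) 1 (begin-strict
        t + (e + f) * q    <⟨ +-mono-<-≤ t<e (*-monoʳ-≤ (e + f) q≤2) ⟩
        e + (e + f) * 2    ≡⟨ solve (e ∷ˡ f ∷ˡ []ˡ) ⟩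
        e + f + f + 2 * e  ∎) key

  -- With `K = a` a pair has `y = t + a (q − z)`, so pairs with `q = z`, and one with `q = z + 1`,
  -- are taken.
  four-k=i : ∀ a {b c} → b * a ≤ c * 2 → ∀ t → t < a → FourBelow a b c a (b * a + c * 2) t
  four-k=i a {b} {c} key t t<a =
    (0 , 0) ∷ (1 , 0) ∷ (1 , 1) ∷ (2 , 2) ∷ [] , literally-unique ,
    (t , solve (t ∷ˡ a ∷ˡ []ˡ) , dominated b c 2 t<a) ∷
    (t + a , solve (t ∷ˡ a ∷ˡ []ˡ) , exchange b c a 2 (+-monoˡ-< a t<a) key) ∷
    (t , solve (t ∷ˡ a ∷ˡ []ˡ) , dominated b c 1 t<a) ∷
    (t , solve (t ∷ˡ a ∷ˡ []ˡ) , dominated b c 0 t<a) ∷ []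

  ≤-slack : ∀ {m n} d → m + d ≡ n → m ≤ n
  ≤-slack {m} d refl = m≤m+n m d

  -- Expresses `n − m = p − q ≥ 0` by an identity that the ring solver can check without
  -- subtraction.
  ≤-balance : ∀ {m n p q} → q ≤ p → m + p ≡ n + q → m ≤ n
  ≤-balance {m} {n} {p} {q} q≤p eq =
    +-cancelʳ-≤ q _ _ (≤-trans (+-monoʳ-≤ m q≤p) (≤-reflexive eq))

  <-slack : ∀ {k m n} d → k < m → m + d ≡ n → k < n
  <-slack d k<m eq = <-≤-trans k<m (≤-slack d eq)

  -- The numbers `e`, `f`, `g`, `h` are `F (i − 1)` down to `F (i − 4)`, and `K = e`. The bound is
  -- attained at `t = g − 1`, where the pair `(2 , 3)` has `suc y = g + h = f`.
  four-k=i∸1 : ∀ a e f g h {b c} → f ≡ g + h → e ≡ f + g → a ≡ e + f →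
           b * (2 * e) ≤ c * 3 → b * (e + f) ≤ c * 2 → b * f ≤ c * 1 →
           ∀ t → t < a → FourBelow a b c e (b * f + c * 3) t
  four-k=i∸1 a e f g h {b} {c} refl refl refl key₀ key₁ key₂ = cases
    where
    bound : ℕ
    bound = b * f + c * 3

    -- The subscript is `z`; the other `3 − z` copies of `c` in the bound pay for the excess of `y`
    -- over `f`.
    bound₀ : ∀ {y} w d → y < w → w + d ≡ f + 2 * e → b * suc y + c * 0 ≤ bound
    bound₀ w d y<w eq = exchange b c (2 * e) 3 (<-slack d y<w eq) key₀
    bound₁ : ∀ {y} → y < a + f → b * suc y + c * 1 ≤ bound
    bound₁ y< = exchange b c (e + f) 2 (<-≤-trans y< (≤-reflexive (+-comm a f))) key₁

    cases : ∀ t → t < a → FourBelow a b c e bound t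
    cases t t<a with ≤-<-connex e t
    ... | inj₁ e≤t with t′ , refl ← m≤n⇒∃[o]m+o≡n e≤t =
      (0 , 0) ∷ (0 , 1) ∷ (1 , 1) ∷ (1 , 2) ∷ [] , literally-unique ,
      (e + t′ , solve (g ∷ˡ h ∷ˡ t′ ∷ˡ []ˡ) ,
        bound₀ a (g + h + g) t<a (solve (g ∷ˡ h ∷ˡ []ˡ))) ∷
      (t′ , solve (g ∷ˡ h ∷ˡ t′ ∷ˡ []ˡ) , dominated b c 2 t′<f) ∷
      (e + t′ + f , solve (g ∷ˡ h ∷ˡ t′ ∷ˡ []ˡ) , bound₁ (+-monoˡ-< f t<a)) ∷
      (t′ + f , solve (g ∷ˡ h ∷ˡ t′ ∷ˡ []ˡ) , exchange b c f 1 (+-monoˡ-< f t′<f) key₂) ∷ []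
      where
      t′<f : t′ < f
      t′<f = +-cancelˡ-< e _ _ t<a
    ... | inj₂ t<e = cases′ (≤-<-connex g t)
      where
      reaches₀₀ : Reaches a b c e bound t (0 , 0)
      reaches₀₀ = t , solve (g ∷ˡ h ∷ˡ t ∷ˡ []ˡ) ,
        bound₀ a (g + h + g) t<a (solve (g ∷ˡ h ∷ˡ []ˡ))
      reaches₁₀ : Reaches a b c e bound t (1 , 0)
      reaches₁₀ = t + a , solve (g ∷ˡ h ∷ˡ t ∷ˡ []ˡ) ,
        bound₀ (e + a) 0 (+-monoˡ-< a t<e) (solve (g ∷ˡ h ∷ˡ []ˡ))
      reaches₁₁ : Reaches a b c e bound t (1 , 1)
      reaches₁₁ = t + f , solve (g ∷ˡ h ∷ˡ t ∷ˡ []ˡ) , bound₁ (+-monoˡ-< f t<a)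
      cases′ : _ → FourBelow a b c e bound t
      cases′ (inj₁ g≤t) with t′ , refl ← m≤n⇒∃[o]m+o≡n g≤t =
        (0 , 0) ∷ (1 , 0) ∷ (1 , 1) ∷ (1 , 2) ∷ [] , literally-unique ,
        reaches₀₀ ∷ reaches₁₀ ∷ reaches₁₁ ∷
        (t′ , solve (g ∷ˡ h ∷ˡ t′ ∷ˡ []ˡ) ,
          dominated b c 1 (+-cancelˡ-< g _ _ (<-≤-trans t<e (≤-reflexive (+-comm f g))))) ∷ []
      cases′ (inj₂ t<g) =
        (0 , 0) ∷ (1 , 0) ∷ (1 , 1) ∷ (2 , 3) ∷ [] , literally-unique ,
        reaches₀₀ ∷ reaches₁₀ ∷ reaches₁₁ ∷
        (t + h , solve (g ∷ˡ h ∷ˡ t ∷ˡ []ˡ) , dominated b c 0 (+-monoˡ-< h t<g)) ∷ []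

  -- The numbers `e`, `f`, `g`, `h` are `F (i − 2)` down to `F (i − 5)`, and `K = e`. Level 0 has
  -- one, two or three pairs according to the position of `t` relative to `e` and `2 e`; level 1
  -- supplies the rest. The bound is attained at `t = a − 1` by the pair `(1 , 5)`.
  four-k=i∸2 : ∀ a e f g h {b c} → f ≡ g + h → e ≡ f + g → a ≡ e + f + e →
           b * (3 * e + g) ≤ c * 5 → b * (2 * e + g) ≤ c * 3 → b * (e + g) ≤ c * 2 →
           b * (2 * g) ≤ c * 1 →
           ∀ t → t < a → FourBelow a b c e (b * h + c * 5) t
  four-k=i∸2 a e f g h {b} {c} refl refl refl key₀ key₂ key₃ key₄ = cases
    where
    bound : ℕ
    bound = b * h + c * 5

    bound₀ : ∀ {y} w d → y < w → w + d ≡ h + (3 * e + g) → b * suc y + c * 0 ≤ bound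
    bound₀ w d y<w eq = exchange b c (3 * e + g) 5 (<-slack d y<w eq) key₀
    bound₁ : ∀ {y} w d → y < w → w + d ≡ h + (2 * e + g) → b * suc y + c * 1 ≤ bound
    bound₁ w d y<w eq = exchange b c (2 * e + g) 4 (<-slack d y<w eq) (≤-trans key₂ (*-monoʳ-≤ c (m≤m+n 3 1)))
    bound₂ : ∀ {y} w d → y < w → w + d ≡ h + (2 * e + g) → b * suc y + c * 2 ≤ bound
    bound₂ w d y<w eq = exchange b c (2 * e + g) 3 (<-slack d y<w eq) key₂
    bound₃ : ∀ {y} w d → y < w → w + d ≡ h + (e + g) → b * suc y + c * 3 ≤ bound
    bound₃ w d y<w eq = exchange b c (e + g) 2 (<-slack d y<w eq) key₃
    bound₄ : ∀ {y} w d → y < w → w + d ≡ h + 2 * g → b * suc y + c * 4 ≤ bound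
    bound₄ w d y<w eq = exchange b c (2 * g) 1 (<-slack d y<w eq) key₄

    cases : ∀ t → t < a → FourBelow a b c e bound t
    cases t t<a with ≤-<-connex e t
    ... | inj₂ t<e =
      (0 , 0) ∷ (1 , 0) ∷ (1 , 1) ∷ (1 , 2) ∷ [] , literally-unique ,
      (t , solve (g ∷ˡ h ∷ˡ t ∷ˡ []ˡ) ,
        bound₀ e (2 * (g + h + g) + g + h) t<e (solve (g ∷ˡ h ∷ˡ []ˡ))) ∷
      (t + a , solve (g ∷ˡ h ∷ˡ t ∷ˡ []ˡ) ,
        bound₀ (e + a) 0 (+-monoˡ-< a t<e) (solve (g ∷ˡ h ∷ˡ []ˡ))) ∷
      (t + (e + f) , solve (g ∷ˡ h ∷ˡ t ∷ˡ []ˡ) ,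
        bound₁ (e + (e + f)) 0 (+-monoˡ-< (e + f) t<e) (solve (g ∷ˡ h ∷ˡ []ˡ))) ∷
      (t + f , solve (g ∷ˡ h ∷ˡ t ∷ˡ []ˡ) ,
        bound₂ (e + f) (g + h + g) (+-monoˡ-< f t<e) (solve (g ∷ˡ h ∷ˡ []ˡ))) ∷ []
    ... | inj₁ e≤t with t₁ , refl ← m≤n⇒∃[o]m+o≡n e≤t with ≤-<-connex e t₁
    ...   | inj₂ t₁<e =
      (0 , 0) ∷ (0 , 1) ∷ (1 , 2) ∷ (1 , 3) ∷ [] , literally-unique ,
      (e + t₁ , solve (g ∷ˡ h ∷ˡ t₁ ∷ˡ []ˡ) ,
        bound₀ a (g + h + g) t<a (solve (g ∷ˡ h ∷ˡ []ˡ))) ∷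
      (t₁ , solve (g ∷ˡ h ∷ˡ t₁ ∷ˡ []ˡ) ,
        bound₁ e (3 * g + 2 * h) t₁<e (solve (g ∷ˡ h ∷ˡ []ˡ))) ∷
      (e + t₁ + f , solve (g ∷ˡ h ∷ˡ t₁ ∷ˡ []ˡ) ,
        bound₂ (e + e + f) 0 (+-monoˡ-< f (+-monoʳ-< e t₁<e)) (solve (g ∷ˡ h ∷ˡ []ˡ))) ∷
      (t₁ + f , solve (g ∷ˡ h ∷ˡ t₁ ∷ˡ []ˡ) ,
        bound₃ (e + f) 0 (+-monoˡ-< f t₁<e) (solve (g ∷ˡ h ∷ˡ []ˡ))) ∷ []
    ...   | inj₁ e≤t₁ with t₂ , refl ← m≤n⇒∃[o]m+o≡n e≤t₁ = last (≤-<-connex g t₂)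
      where
      t₂<f : t₂ < f
      t₂<f = +-cancelˡ-< (e + e) _ _ (≤-<-trans (≤-reflexive (+-assoc e e t₂))
                                        (<-≤-trans t<a (≤-reflexive (rearrange g h))))
        where
        rearrange : ∀ g h → g + h + g + (g + h) + (g + h + g) ≡ (g + h + g) + (g + h + g) + (g + h)
        rearrange g h = solve (g ∷ˡ h ∷ˡ []ˡ)
      reaches₀₀ : Reaches a b c e bound (e + (e + t₂)) (0 , 0)
      reaches₀₀ = e + (e + t₂) , solve (g ∷ˡ h ∷ˡ t₂ ∷ˡ []ˡ) ,
        bound₀ a (g + h + g) t<a (solve (g ∷ˡ h ∷ˡ []ˡ))
      reaches₀₁ : Reaches a b c e bound (e + (e + t₂)) (0 , 1)
      reaches₀₁ = e + t₂ , solve (g ∷ˡ h ∷ˡ t₂ ∷ˡ []ˡ) ,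
        bound₁ (e + f) (g + h + g) (+-monoʳ-< e t₂<f) (solve (g ∷ˡ h ∷ˡ []ˡ))
      reaches₀₂ : Reaches a b c e bound (e + (e + t₂)) (0 , 2)
      reaches₀₂ = t₂ , solve (g ∷ˡ h ∷ˡ t₂ ∷ˡ []ˡ) ,
        bound₂ f (2 * (g + h + g)) t₂<f (solve (g ∷ˡ h ∷ˡ []ˡ))
      last : _ → FourBelow a b c e bound (e + (e + t₂))
      last (inj₂ t₂<g) =
        (0 , 0) ∷ (0 , 1) ∷ (0 , 2) ∷ (1 , 4) ∷ [] , literally-unique ,
        reaches₀₀ ∷ reaches₀₁ ∷ reaches₀₂ ∷
        (t₂ + f , solve (g ∷ˡ h ∷ˡ t₂ ∷ˡ []ˡ) ,
          bound₄ (g + f) 0 (+-monoˡ-< f t₂<g) (solve (g ∷ˡ h ∷ˡ []ˡ))) ∷ []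
      last (inj₁ g≤t₂) with t₃ , refl ← m≤n⇒∃[o]m+o≡n g≤t₂ =
        (0 , 0) ∷ (0 , 1) ∷ (0 , 2) ∷ (1 , 5) ∷ [] , literally-unique ,
        reaches₀₀ ∷ reaches₀₁ ∷ reaches₀₂ ∷
        (t₃ , solve (g ∷ˡ h ∷ˡ t₃ ∷ˡ []ˡ) , dominated b c 0 (+-cancelˡ-< g _ _ t₂<f)) ∷ []

  -- Write `t = σ + τ K` with `σ < K`. Level 0 offers the `τ + 1` values `z ≤ τ`, and level 1 makes
  -- up for what is missing. Adding `a` adds `S` to `σ`, and whether this carries past `K` decides
  -- which of the two bounds on `B` is used.
  four-r≥3 : ∀ S ρ K {a b c B} .{{_ : NonZero K}} → S ≤ K → a ≡ S + (3 + ρ) * K → b * K ≤ c * 2 →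
           b * S + c * (6 + ρ) ≤ B → b * K + c * (5 + ρ) ≤ B →
           ∀ t → t < a → FourBelow a b c K B t
  four-r≥3 S ρ K {a} {b} {c} {B} S≤K a≡ bK≤2c S-bound K-bound t t<a =
    subst (FourBelow a b c K B) (sym t≡)
      (cases (t / K) (m%n<n t K) (subst₂ _<_ t≡ a≡ t<a))
    where
    t≡ : t ≡ t % K + t / K * K
    t≡ = m≡m%n+[m/n]*n t K

    -- By b K ≤ 2 c, moving from (ω , j + z) to (ω + j K , z) costs at most j c.
    descend : ∀ j {ω z Y} → ω < Y → b * Y + c * (2 * j + z) ≤ B → b * suc (ω + j * K) + c * z ≤ B
    descend j {ω} {z} {Y} ω<Y bound = begin
      b * (1 + (ω + j * K)) + c * z      ≡⟨ solve (b ∷ˡ c ∷ˡ K ∷ˡ ω ∷ˡ j ∷ˡ z ∷ˡ []ˡ) ⟩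
      b * (1 + ω) + (b * K) * j + c * z  ≤⟨ +-monoˡ-≤ (c * z) (+-mono-≤ (*-monoʳ-≤ b ω<Y) (*-monoˡ-≤ j bK≤2c)) ⟩
      b * Y + c * 2 * j + c * z          ≡⟨ solve (b ∷ˡ c ∷ˡ Y ∷ˡ j ∷ˡ z ∷ˡ []ˡ) ⟩
      b * Y + c * (2 * j + z)            ≤⟨ bound ⟩
      B                                  ∎
      where open ≤-Reasoning

    lower : ∀ {Y z} w → b * Y + c * w ≤ B → z ≤ w → b * Y + c * z ≤ B
    lower {Y} w bound z≤w = ≤-trans (+-monoʳ-≤ (b * Y) (*-monoʳ-≤ c z≤w)) bound

    point : ∀ {t} j {ω z q Y} → t + a * q ≡ ω + K * (j + z) → ω < Y →
            b * Y + c * (2 * j + z) ≤ B → Reaches a b c K B t (q , z)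
    point j {ω} {z} eq ω<Y bound = ω + j * K , trans regroup (sym eq) , descend j ω<Y bound
      where
      regroup : ω + j * K + K * z ≡ ω + K * (j + z)
      regroup = solve (ω ∷ˡ j ∷ˡ K ∷ˡ z ∷ˡ []ˡ)

    level₀ : ∀ σ τ → σ + τ * K + a * 0 ≡ σ + K * τ
    level₀ σ τ = solve (σ ∷ˡ τ ∷ˡ K ∷ˡ a ∷ˡ []ˡ)

    -- Division of `t + a` by `K`, with remainder `ω`. A carry makes `ζ = 1 + ρ` but also `ω < S`;
    -- otherwise `ζ = ρ` and only `ω < K` is known.
    level₁ : ∀ σ τ → σ < K → ∃ λ ω → ∃₂ λ ζ Y →
             σ + τ * K + a * 1 ≡ ω + K * (3 + τ + ζ) × ω < Y × b * Y + c * (5 + ζ) ≤ B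
    level₁ σ τ σ<K with ≤-<-connex K (σ + S)
    ... | inj₁ K≤σ+S with ω , K+ω≡ ← m≤n⇒∃[o]m+o≡n K≤σ+S =
      ω , 1 + ρ , S , eq , +-cancelˡ-< K _ _ (≤-<-trans (≤-reflexive K+ω≡) (+-monoˡ-< S σ<K)) , S-bound
      where
      open ≡-Reasoning
      eq : σ + τ * K + a * 1 ≡ ω + K * (3 + τ + (1 + ρ))
      eq = begin
        σ + τ * K + a * 1                    ≡⟨ cong (λ s → σ + τ * K + s * 1) a≡ ⟩
        σ + τ * K + (S + (3 + ρ) * K) * 1    ≡⟨ solve (σ ∷ˡ τ ∷ˡ K ∷ˡ S ∷ˡ ρ ∷ˡ []ˡ) ⟩
        σ + S + (3 + τ + ρ) * K              ≡⟨ cong (_+ (3 + τ + ρ) * K) K+ω≡ ⟨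
        K + ω + (3 + τ + ρ) * K              ≡⟨ solve (ω ∷ˡ τ ∷ˡ K ∷ˡ ρ ∷ˡ []ˡ) ⟩
        ω + K * (3 + τ + (1 + ρ))            ∎
    ... | inj₂ σ+S<K = σ + S , ρ , K , eq , σ+S<K , K-bound
      where
      open ≡-Reasoning
      eq : σ + τ * K + a * 1 ≡ σ + S + K * (3 + τ + ρ)
      eq = begin
        σ + τ * K + a * 1                    ≡⟨ cong (λ s → σ + τ * K + s * 1) a≡ ⟩
        σ + τ * K + (S + (3 + ρ) * K) * 1    ≡⟨ solve (σ ∷ˡ τ ∷ˡ K ∷ˡ S ∷ˡ ρ ∷ˡ []ˡ) ⟩
        σ + S + K * (3 + τ + ρ)              ∎

    -- The quotient `3 + τ` is at most `3 + ρ`, and if they are equal then `t < a` gives `σ < S`.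
    top₀ : ∀ {σ} τ → σ < K → σ + (3 + τ) * K < S + (3 + ρ) * K →
           ∃ λ Y → σ < Y × b * Y + c * (6 + τ) ≤ B
    top₀ {σ} τ σ<K t<a with m≤n⇒m<n∨m≡n (s≤s⁻¹ (+-cancelˡ-< 3 _ _ (*-cancelʳ-< K (3 + τ) (4 + ρ) (begin-strict
        (3 + τ) * K        ≤⟨ m≤n+m _ σ ⟩
        σ + (3 + τ) * K    <⟨ t<a ⟩
        S + (3 + ρ) * K    ≤⟨ +-monoˡ-≤ _ S≤K ⟩
        K + (3 + ρ) * K    ∎))))
      where open ≤-Reasoning
    ... | inj₁ τ<ρ  = K , σ<K , lower (5 + ρ) K-bound (+-monoʳ-≤ 5 τ<ρ)
    ... | inj₂ refl = S , +-cancelʳ-< ((3 + τ) * K) _ _ t<a , S-bound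

    cases : ∀ {σ} τ → σ < K → σ + τ * K < S + (3 + ρ) * K → FourBelow a b c K B (σ + τ * K)
    -- For `τ ≤ 2` the pairs on level 1 have `z = 3 + τ + ζ − j` with `j ≤ 2 − τ`. Hence
    -- `2 j + z ≤ 5 + ζ`, with equality for the last pair.
    cases {σ} 0 σ<K _ with ω , ζ , Y , eq , ω<Y , bound ← level₁ σ 0 σ<K =
      (0 , 0) ∷ (1 , 3 + ζ) ∷ (1 , 2 + ζ) ∷ (1 , 1 + ζ) ∷ [] ,
      ((λ ()) ∷ (λ ()) ∷ (λ ()) ∷ []) ∷ ((λ ()) ∷ (λ ()) ∷ []) ∷ ((λ ()) ∷ []) ∷ [] ∷ [] ,
      point 0 (level₀ σ 0) σ<K (lower (5 + ρ) K-bound z≤n) ∷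
      point 0 eq ω<Y (lower (5 + ζ) bound (m≤n+m _ 2)) ∷
      point 1 eq ω<Y (lower (5 + ζ) bound (m≤n+m _ 1)) ∷
      point 2 eq ω<Y bound ∷ []
    cases {σ} 1 σ<K _ with ω , ζ , Y , eq , ω<Y , bound ← level₁ σ 1 σ<K =
      (0 , 1) ∷ (0 , 0) ∷ (1 , 4 + ζ) ∷ (1 , 3 + ζ) ∷ [] ,
      ((λ ()) ∷ (λ ()) ∷ (λ ()) ∷ []) ∷ ((λ ()) ∷ (λ ()) ∷ []) ∷ ((λ ()) ∷ []) ∷ [] ∷ [] ,
      point 0 (level₀ σ 1) σ<K (lower (5 + ρ) K-bound (m≤m+n 1 _)) ∷
      point 1 (level₀ σ 1) σ<K (lower (5 + ρ) K-bound (m≤m+n 2 _)) ∷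
      point 0 eq ω<Y (lower (5 + ζ) bound (m≤n+m _ 1)) ∷
      point 1 eq ω<Y bound ∷ []
    cases {σ} 2 σ<K _ with ω , ζ , Y , eq , ω<Y , bound ← level₁ σ 2 σ<K =
      (0 , 2) ∷ (0 , 1) ∷ (0 , 0) ∷ (1 , 5 + ζ) ∷ [] ,
      ((λ ()) ∷ (λ ()) ∷ (λ ()) ∷ []) ∷ ((λ ()) ∷ (λ ()) ∷ []) ∷ ((λ ()) ∷ []) ∷ [] ∷ [] ,
      point 0 (level₀ σ 2) σ<K (lower (5 + ρ) K-bound (m≤m+n 2 _)) ∷
      point 1 (level₀ σ 2) σ<K (lower (5 + ρ) K-bound (m≤m+n 3 _)) ∷
      point 2 (level₀ σ 2) σ<K (lower (5 + ρ) K-bound (m≤m+n 4 _)) ∷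
      point 0 eq ω<Y bound ∷ []
    cases {σ} (suc (suc (suc τ))) σ<K t<a with Y , σ<Y , bound ← top₀ τ σ<K t<a =
      (0 , 3 + τ) ∷ (0 , 2 + τ) ∷ (0 , 1 + τ) ∷ (0 , τ) ∷ [] ,
      ((λ ()) ∷ (λ ()) ∷ (λ ()) ∷ []) ∷ ((λ ()) ∷ (λ ()) ∷ []) ∷ ((λ ()) ∷ []) ∷ [] ∷ [] ,
      point 0 (level₀ σ (3 + τ)) σ<Y (lower (6 + τ) bound (m≤n+m _ 3)) ∷
      point 1 (level₀ σ (3 + τ)) σ<Y (lower (6 + τ) bound (m≤n+m _ 2)) ∷
      point 2 (level₀ σ (3 + τ)) σ<Y (lower (6 + τ) bound (m≤n+m _ 1)) ∷
      point 3 (level₀ σ (3 + τ)) σ<Y bound ∷ []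

  -- Fibonacci numbers

  F-step : ∀ n → F n ≤ F (suc n)
  F-step zero    = z≤n
  F-step (suc n) = m≤m+n _ (F n)

  F-mono : ∀ {m n} → m ≤ n → F m ≤ F n
  F-mono = go ∘ ≤⇒≤′
    where
    go : ∀ {m n} → m ≤′ n → F m ≤ F n
    go ≤′-refl       = ≤-refl
    go (≤′-step {n} m≤n) = ≤-trans (go m≤n) (F-step n)

  F-positive : ∀ {n} → 1 ≤ n → 1 ≤ F n
  F-positive = F-mono

  2*F≤F : ∀ n → 2 * F n ≤ F (2 + n)
  2*F≤F n = +-mono-≤ (F-step n) (≤-reflexive (+-identityʳ (F n)))

  F-coprime-suc : ∀ n → Coprime (F n) (F (suc n))
  F-coprime-suc zero    = Coprimality.sym (1-coprimeTo 0)
  F-coprime-suc (suc n) = Coprimality.sym (coprime-+ (F-coprime-suc n))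

  F-coprime : ∀ n → Coprime (F n) (F (2 + n))
  F-coprime n = subst (Coprime (F n)) (+-comm (F n) (F (suc n)))
    (Coprimality.sym (coprime-+ (Coprimality.sym (F-coprime-suc n))))

  -- Both sides obey the Fibonacci recurrence in `j`, so the values at 0 and 1 decide.
  F-relation : ∀ i j → F (2 + j + i) + F i * F j ≡ F (2 + i) * F (2 + j)
  F-relation i 0 = lemma (F i) (F (2 + i))
    where
    lemma : ∀ p q → q + p * 0 ≡ q * 1
    lemma p q = solve (p ∷ˡ q ∷ˡ []ˡ)
  F-relation i 1 = lemma (F i) (F (1 + i))
    where
    lemma : ∀ p q → q + p + q + p * 1 ≡ (q + p) * 2
    lemma p q = solve (p ∷ˡ q ∷ˡ []ˡ)
  F-relation i (suc (suc j)) =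
    trans (regroup (F i) (F (3 + j + i)) (F (2 + j + i)) (F (1 + j)) (F j))
      (trans (cong₂ _+_ (F-relation i (suc j)) (F-relation i j))
             (sym (*-distribˡ-+ (F (2 + i)) (F (3 + j)) (F (2 + j)))))
    where
    regroup : ∀ p x y u v → x + y + p * (u + v) ≡ (x + p * u) + (y + p * v)
    regroup p x y u v = solve (p ∷ˡ x ∷ˡ y ∷ˡ u ∷ˡ v ∷ˡ []ˡ)

  -- The parameter `j` is `k − 2`, which spares `K′` the truncated subtraction.
  module FibonacciTriple (i j : ℕ) (1≤i : 1 ≤ i) (1≤j : 1 ≤ j) where
    private
      a b c K K′ : ℕ
      a  = F i
      b  = F (2 + i)
      c  = F (2 + j + i)
      K  = F (2 + j)
      K′ = F j

    open ThreeGenerators {a} {b} {c} {K} {K′}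
      {{F-nonZero {0} {i} 1≤i}} {{F-nonZero {0} {2 + i} z<s}}
      {{F-nonZero {0} {2 + j + i} z<s}} {{F-nonZero {0} {2 + j} z<s}}
      (F-coprime i) (F-relation i j) public

    a≤b : a ≤ b
    a≤b = m≤n+m (F i) (F (suc i))

    a+b≤ : ∀ {Y Z} → 1 ≤ Y → 1 ≤ Z → a + b ≤ b * Y + c * Z
    a+b≤ {Y} {Z} 1≤Y 1≤Z = begin
      a + b          ≡⟨ +-comm a b ⟩
      b + a          ≤⟨ +-mono-≤ (m≤m*n b Y {{>-nonZero 1≤Y}}) (≤-trans a≤c (m≤m*n c Z {{>-nonZero 1≤Z}})) ⟩
      b * Y + c * Z  ∎
      where
      open ≤-Reasoning
      a≤c : a ≤ c
      a≤c = ≤-trans (m≤m*n a K′ {{F-nonZero {0} {j} 1≤j}}) (aK′≤c a≤b (2*F≤F j))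

    -- The premise `K′ ≤ b` holds whenever `k ≤ i + 4`.
    near : ∀ {Y} → K′ ≤ b → ∀ q → 1 ≤ q → K ≤ Y + a * q → K′ ≤ b * q
    near K′≤b q 1≤q _ = ≤-trans K′≤b (m≤m*n b q {{>-nonZero 1≤q}})

    -- The variables `b′`, `c′` and `G` admit the forms used in the theorem, such as `F (i + 2)` for
    -- `F (2 + i)`.
    isFrobeniusNumber : ∀ Y Z table {b′ c′ G} → b′ ≡ b → c′ ≡ c →
      G ≡ (+ Y ℤ.- + 1) ℤ.* + b′ ℤ.+ + Z ℤ.* + c′ ℤ.- + F i →
      Y ≤ K → (∀ q → 1 ≤ q → K ≤ Y + a * q → K′ ≤ b * q) →
      a + b ≤ b * Y + c * Z → Complete table (Y + K * Z) →
      (∀ t → t < a → FourBelow a b c K (b * Y + c * Z) t) →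
      IsFrobeniusNumber 3 (F i ∷ b′ ∷ c′ ∷ []) G
    isFrobeniusNumber Y Z table refl refl refl Y≤K =
      frobenius Y Z table Y≤K (2*F≤F j) a≤b

  -- The cases, by the size of k relative to i

  one-c : ∀ (Y b c a : ℤ) → (Y ℤ.- + 1) ℤ.* b ℤ.+ c ℤ.- a ≡ (Y ℤ.- + 1) ℤ.* b ℤ.+ + 1 ℤ.* c ℤ.- a
  one-c Y b c a = cong (λ s → (Y ℤ.- + 1) ℤ.* b ℤ.+ s ℤ.- a) (sym (ℤ.*-identityˡ c))

  module _ (m : ℕ) where
    private
      i : ℕ
      i = 3 + m
      1≤i : 1 ≤ i
      1≤i = s≤s z≤n
      b≡ : F (i + 2) ≡ F (2 + i)
      b≡ = cong F (+-comm i 2)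

    g₃-k=i+2 : IsFrobeniusNumber 3 (F i ∷ F (i + 2) ∷ F (2 * i + 2) ∷ [])
               ((+ F i ℤ.- + 1) ℤ.* + F (i + 2) ℤ.+ + F (2 * i + 2) ℤ.- + F i)
    g₃-k=i+2 = isFrobeniusNumber (F i) 1 table-1-1-1 b≡ (cong F index)
      (one-c (+ F i) (+ F (i + 2)) (+ F (2 * i + 2)) (+ F i))
      a≤b (near (F-mono (m≤n+m i 2))) (a+b≤ (F-positive 1≤i) ≤-refl)
      (complete-1-1-1 (w≤4a (F i) (F (2 + m)) (F-step (2 + m)))
        (≤-reflexive (w≡ (F i) (F (2 + i)))))
      (four-k=i+2 (F i) (F (2 + m)) {F (2 + i)} {F (2 + i + i)} (K≡ (F i) (F (2 + m))) (F-step (2 + m))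
        (cleared (F i * 2) 1 (key (F m) (F (1 + m)))))
      where
      open FibonacciTriple i i 1≤i 1≤i
      index : 2 * i + 2 ≡ 2 + i + i
      index = cong (λ s → 3 + s) (lemma m)
        where
        lemma : ∀ m → m + (3 + (m + 0)) + 2 ≡ 2 + m + (3 + m)
        lemma m = solve (m ∷ˡ []ˡ)
      K≡ : ∀ a e → a + e + a ≡ 2 * a + e
      K≡ a e = solve (a ∷ˡ e ∷ˡ []ˡ)
      w≤4a : ∀ a e → e ≤ a → a + (a + e + a) * 1 ≤ a * 4
      w≤4a a e e≤a = begin
        a + (a + e + a) * 1  ≡⟨ solve (a ∷ˡ e ∷ˡ []ˡ) ⟩
        a * 3 + e            ≤⟨ +-monoʳ-≤ (a * 3) e≤a ⟩
        a * 3 + a            ≡⟨ solve (a ∷ˡ []ˡ) ⟩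
        a * 4                ∎
        where open ≤-Reasoning
      w≡ : ∀ a K → a + K * 1 ≡ K * 1 + a * 1
      w≡ a K = solve (a ∷ˡ K ∷ˡ []ˡ)
      -- Here `K = b` and `K′ = a`. As in the later `key` inequalities, expressing everything in two
      -- Fibonacci numbers makes the difference of the sides a quadratic form.
      key : ∀ l f → let e = f + l; a = e + f; b = a + e + a in b * (a * 2) + a * a * 1 ≤ b * b * 1
      key l f = ≤-slack (f * f + 4 * (f * l) + 2 * (l * l)) (solve (l ∷ˡ f ∷ˡ []ˡ))

    g₃-k=i+1 : IsFrobeniusNumber 3 (F i ∷ F (i + 2) ∷ F (2 * i + 1) ∷ [])
               ((+ F i ℤ.+ + F (i ∸ 2) ℤ.- + 1) ℤ.* + F (i + 2) ℤ.+ + F (2 * i + 1) ℤ.- + F i)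
    g₃-k=i+1 = isFrobeniusNumber (F i + F (1 + m)) 1 table-2-1 b≡ (cong F index)
      (one-c (+ (F i + F (1 + m))) (+ F (i + 2)) (+ F (2 * i + 1)) (+ F i))
      (+-monoʳ-≤ (F i) (F-step (1 + m))) (near (F-mono (m≤n+m (2 + m) 3)))
      (a+b≤ (≤-trans (F-positive 1≤i) (m≤m+n (F i) (F (1 + m)))) ≤-refl)
      (complete-2-1 (w₁ (F (2 + m)) (F (1 + m))) (w₂ (F (2 + m)) (F (1 + m))) (w₃ (F (2 + m)) (F (1 + m))))
      (four-k=i+1 (F (2 + m)) (F (1 + m)) {F (2 + i)} {F (4 + m + i)}
      (cleared (2 * F (2 + m)) 1 (key (F-step m))))
      where
      open FibonacciTriple i (2 + m) 1≤i (s≤s z≤n)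
      index : 2 * i + 1 ≡ 4 + m + i
      index = cong (λ s → 3 + s) (lemma m)
        where
        lemma : ∀ m → m + (3 + (m + 0)) + 1 ≡ 1 + m + (3 + m)
        lemma m = solve (m ∷ˡ []ˡ)
      w₁ : ∀ e f → e + f + f + (e + f + e) * 1 ≤ (e + f) * 3
      w₁ e f = ≤-reflexive (solve (e ∷ˡ f ∷ˡ []ˡ))
      w₂ : ∀ e f → e + f + f + (e + f + e) * 1 ≤ (e + f + e) * 2 + (e + f) * 1
      w₂ e f = ≤-slack (2 * e) (solve (e ∷ˡ f ∷ˡ []ˡ))
      w₃ : ∀ e f → e + f + f + (e + f + e) * 1 ≤ (e + f + e) * 1 + (e + f) * 2
      w₃ e f = ≤-slack e (solve (e ∷ˡ f ∷ˡ []ˡ))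
      -- The difference is `3 f² − l²`, which is why `l ≤ f` is assumed.
      key : ∀ {l f} → l ≤ f → let e = f + l; a = e + f; K = a + e; b = K + a in
            b * (2 * e) + a * e * 1 ≤ b * K * 1
      key {l} {f} l≤f = ≤-balance (*-mono-≤ (m≤m+n 1 2) (*-mono-≤ l≤f l≤f)) (expanded l f)
        where
        expanded : ∀ l f → let e = f + l; a = e + f; K = a + e; b = K + a in
                   b * (2 * e) + a * e * 1 + 3 * (f * f) ≡ b * K * 1 + 1 * (l * l)
        expanded l f = solve (l ∷ˡ f ∷ˡ []ˡ)

    g₃-k=i : IsFrobeniusNumber 3 (F i ∷ F (i + 2) ∷ F (2 * i) ∷ [])
               ((+ F i ℤ.- + 1) ℤ.* + F (i + 2) ℤ.+ + 2 ℤ.* + F (2 * i) ℤ.- + F i)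
    g₃-k=i = isFrobeniusNumber (F i) 2 table-2-1 b≡ (cong F index) refl
      ≤-refl (near (F-mono (m≤n+m (1 + m) 4))) (a+b≤ (F-positive 1≤i) (s≤s z≤n))
      (complete-2-1 (≤-reflexive (w₁ (F i))) (≤-reflexive (w₂ (F i))) (≤-reflexive (w₃ (F i))))
      (four-k=i (F i) {F (2 + i)} {F (3 + m + i)} (bK≤2c a≤b (2*F≤F (1 + m))))
      where
      open FibonacciTriple i (1 + m) 1≤i (s≤s z≤n)
      index : 2 * i ≡ 3 + m + i
      index = cong (λ s → 3 + s) (cong (λ s → m + (3 + s)) (+-identityʳ m))
      w₁ : ∀ a → a + a * 2 ≡ a * 3
      w₁ a = solve (a ∷ˡ []ˡ)
      w₂ : ∀ a → a + a * 2 ≡ a * 2 + a * 1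
      w₂ a = solve (a ∷ˡ []ˡ)
      w₃ : ∀ a → a + a * 2 ≡ a * 1 + a * 2
      w₃ a = solve (a ∷ˡ []ˡ)

  g₃-k=i∸1 : ∀ {i} → i ≥ 4 → IsFrobeniusNumber 3 (F i ∷ F (i + 2) ∷ F (2 * i ∸ 1) ∷ [])
             ((+ F (i ∸ 2) ℤ.- + 1) ℤ.* + F (i + 2) ℤ.+ + 3 ℤ.* + F (2 * i ∸ 1) ℤ.- + F i)
  g₃-k=i∸1 (s≤s (s≤s (s≤s (s≤s (z≤n {m}))))) =
    isFrobeniusNumber (F (2 + m)) 3 table-2-1 (cong F (+-comm i 2)) (cong F index) refl
    (F-step (2 + m)) (near (F-mono (m≤n+m (1 + m) 5))) (a+b≤ (F-positive {2 + m} (s≤s z≤n)) (s≤s z≤n))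
    (complete-2-1 (w₁ (F (3 + m)) (F (2 + m))) (w₂ (F (3 + m)) (F (2 + m))) (w₃ (F (3 + m)) (F (2 + m))))
    (four-k=i∸1 (F i) (F (3 + m)) (F (2 + m)) (F (1 + m)) (F m) {F (2 + i)} {F (3 + m + i)} refl refl refl
      (cleared (2 * F (3 + m)) 3 (key₀ (F (1 + m)) (F m)))
      (cleared (F (3 + m) + F (2 + m)) 2 (key₁ (F (1 + m)) (F m)))
      (cleared (F (2 + m)) 1 (key₂ (F (1 + m)) (F m))))
    where
    i : ℕ
    i = 4 + m
    open FibonacciTriple i (1 + m) (s≤s z≤n) (s≤s z≤n)
    index : 2 * i ∸ 1 ≡ 3 + m + i
    index = cong (λ s → 3 + s) (cong (λ s → m + (4 + s)) (+-identityʳ m))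
    w₁ : ∀ e f → f + e * 3 ≤ (e + f) * 3
    w₁ e f = ≤-slack (2 * f) (solve (e ∷ˡ f ∷ˡ []ˡ))
    w₂ : ∀ e f → f + e * 3 ≤ e * 2 + (e + f) * 1
    w₂ e f = ≤-reflexive (solve (e ∷ˡ f ∷ˡ []ˡ))
    w₃ : ∀ e f → f + e * 3 ≤ e * 1 + (e + f) * 2
    w₃ e f = ≤-slack f (solve (e ∷ˡ f ∷ˡ []ˡ))
    key₀ : ∀ g h → let f = g + h; e = f + g; a = e + f; b = a + e + a in
           b * (2 * e) + a * g * 3 ≤ b * e * 3
    key₀ g h = ≤-slack (7 * (g * g) + 12 * (g * h) + 5 * (h * h)) (solve (g ∷ˡ h ∷ˡ []ˡ))
    key₁ : ∀ g h → let f = g + h; e = f + g; a = e + f; b = a + e + a in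
           b * (e + f) + a * g * 2 ≤ b * e * 2
    key₁ g h = ≤-slack (2 * (g * g) + g * h) (solve (g ∷ˡ h ∷ˡ []ˡ))
    key₂ : ∀ g h → let f = g + h; e = f + g; a = e + f; b = a + e + a in
           b * f + a * g * 1 ≤ b * e * 1
    key₂ g h = ≤-slack (5 * (g * g) + 3 * (g * h)) (solve (g ∷ˡ h ∷ˡ []ˡ))

  g₃-k=i∸2 : ∀ {i} → i ≥ 6 → IsFrobeniusNumber 3 (F i ∷ F (i + 2) ∷ F (2 * i ∸ 2) ∷ [])
             ((+ F (i ∸ 5) ℤ.- + 1) ℤ.* + F (i + 2) ℤ.+ + 5 ℤ.* + F (2 * i ∸ 2) ℤ.- + F i)
  g₃-k=i∸2 (s≤s (s≤s (s≤s (s≤s (s≤s (s≤s (z≤n {m}))))))) =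
    isFrobeniusNumber (F (1 + m)) 5 table-3 (cong F (+-comm i 2)) (cong F index) refl
    (F-mono (m≤n+m (1 + m) 3)) (near (F-mono (m≤n+m (2 + m) 6)))
    (a+b≤ (F-positive {1 + m} (s≤s z≤n)) (s≤s z≤n))
    (complete-3 (w₁ (F (2 + m)) (F (1 + m))) (w₂ (F (2 + m)) (F (1 + m))))
    (four-k=i∸2 (F i) (F (4 + m)) (F (3 + m)) (F (2 + m)) (F (1 + m)) {F (2 + i)} {F (4 + m + i)}
      refl refl refl
      (cleared (3 * F (4 + m) + F (2 + m)) 5 (key₀ (F (2 + m)) (F (1 + m))))
      (cleared (2 * F (4 + m) + F (2 + m)) 3 (key₂ (F-step m)))
      (cleared (F (4 + m) + F (2 + m)) 2 (key₃ (F (2 + m)) (F (1 + m))))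
      (cleared (2 * F (2 + m)) 1 (key₄ (F-step m))))
    where
    i : ℕ
    i = 6 + m
    open FibonacciTriple i (2 + m) (s≤s z≤n) (s≤s z≤n)
    index : 2 * i ∸ 2 ≡ 4 + m + i
    index = cong (λ s → 4 + s) (cong (λ s → m + (6 + s)) (+-identityʳ m))
    w₁ : ∀ g h → let f = g + h; e = f + g; a = e + f + e in h + e * 5 ≤ a * 2
    w₁ g h = ≤-reflexive (solve (g ∷ˡ h ∷ˡ []ˡ))
    w₂ : ∀ g h → let f = g + h; e = f + g; a = e + f + e in h + e * 5 ≤ e * 3 + a * 1
    w₂ g h = ≤-slack g (solve (g ∷ˡ h ∷ˡ []ˡ))
    key₀ : ∀ g h → let f = g + h; e = f + g; a = e + f + e; b = a + (e + f) + a in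
           b * (3 * e + g) + a * g * 5 ≤ b * e * 5
    key₀ g h = ≤-slack (14 * (g * g) + 35 * (g * h) + 16 * (h * h)) (solve (g ∷ˡ h ∷ˡ []ˡ))
    -- In `g` and `h` the difference is `8 h² + 12 g h − 2 g²`; writing `g = h + l` with `l ≤ h`
    -- controls the negative term.
    key₂ : ∀ {l h} → l ≤ h → let g = h + l; f = g + h; e = f + g; a = e + f + e; b = a + (e + f) + a in
           b * (2 * e + g) + a * g * 3 ≤ b * e * 3
    key₂ {l} {h} l≤h = ≤-balance
      (≤-trans (*-mono-≤ (m≤m+n 2 16) (*-mono-≤ l≤h l≤h)) (m≤m+n _ (8 * (h * l)))) (expanded l h)
      where
      expanded : ∀ l h → let g = h + l; f = g + h; e = f + g; a = e + f + e; b = a + (e + f) + a in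
                 b * (2 * e + g) + a * g * 3 + (18 * (h * h) + 8 * (h * l)) ≡ b * e * 3 + 2 * (l * l)
      expanded l h = solve (l ∷ˡ h ∷ˡ []ˡ)
    key₃ : ∀ g h → let f = g + h; e = f + g; a = e + f + e; b = a + (e + f) + a in
           b * (e + g) + a * g * 2 ≤ b * e * 2
    key₃ g h = ≤-slack (3 * (g * g) + 15 * (g * h) + 8 * (h * h)) (solve (g ∷ˡ h ∷ˡ []ˡ))
    key₄ : ∀ {l h} → l ≤ h → let g = h + l; f = g + h; e = f + g; a = e + f + e; b = a + (e + f) + a in
           b * (2 * g) + a * g * 1 ≤ b * e * 1
    key₄ {l} {h} l≤h = ≤-balance (*-mono-≤ (m≤m+n 5 8) (*-mono-≤ l≤h l≤h)) (expanded l h)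
      where
      expanded : ∀ l h → let g = h + l; f = g + h; e = f + g; a = e + f + e; b = a + (e + f) + a in
                 b * (2 * g) + a * g * 1 + 13 * (h * h) ≡ b * e * 1 + 5 * (l * l)
      expanded l h = solve (l ∷ˡ h ∷ˡ []ˡ)

  g₃-k≥i+3 : ∀ m {k} → let i = 3 + m in k ≥ i + 3 →
           IsFrobeniusNumber 3 (F i ∷ F (i + 2) ∷ F (i + k) ∷ [])
             ((+ 4 ℤ.* + F i ℤ.- + 1) ℤ.* + F (i + 2) ℤ.- + F i)
  g₃-k≥i+3 m {k} k≥ with n , refl ← m≤n⇒∃[o]m+o≡n k≥ =
    isFrobeniusNumber (4 * F i) 0 table-1-1-1 (cong F (+-comm i 2)) (cong F index)
      (G≡ (F i) (+ F (i + 2)) (+ F (i + (i + 3 + n))))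
      4a≤K near-k≥i+3 (a+b≤b*4a (F i) (F (2 + i)) (F (2 + j + i)) (F-positive {i} (s≤s z≤n)) a≤b)
      (complete-1-1-1 (w₁ (F i) (F (2 + j))) (w₂ (F i) (F (2 + j)) 4a≤K))
      (four-k≥i+3 (F i) {F (2 + i)} {F (2 + j + i)} {F (2 + j)})
    where
    i j : ℕ
    i = 3 + m
    j = 1 + i + n
    open FibonacciTriple i j (s≤s z≤n) (s≤s z≤n)
    open ≤-Reasoning

    index : i + (i + 3 + n) ≡ 2 + j + i
    index = cong (λ s → 3 + s) (lemma m n)
      where
      lemma : ∀ m n → m + (3 + (m + 3) + n) ≡ 3 + m + n + (3 + m)
      lemma m n = solve (m ∷ˡ n ∷ˡ []ˡ)

    G≡ : ∀ a b c → (+ 4 ℤ.* + a ℤ.- + 1) ℤ.* b ℤ.- + a ≡ (+ (4 * a) ℤ.- + 1) ℤ.* b ℤ.+ + 0 ℤ.* c ℤ.- + a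
    G≡ a b c = trans (lemma (+ 4 ℤ.* + a) (+ a) b c)
      (cong (λ s → (s ℤ.- + 1) ℤ.* b ℤ.+ + 0 ℤ.* c ℤ.- + a) (sym (ℤ.pos-* 4 a)))
      where
      lemma : ∀ s a b c → (s ℤ.- + 1) ℤ.* b ℤ.- a ≡ (s ℤ.- + 1) ℤ.* b ℤ.+ + 0 ℤ.* c ℤ.- a
      lemma = ℤSolver.solve-∀

    -- This is the condition `Y ≤ K`, which would fail for `k = i + 2`.
    4a≤K : 4 * F i ≤ F (2 + j)
    4a≤K = ≤-trans (lemma (F (2 + m)) (F (1 + m)) (F-step (1 + m))) (F-mono (m≤m+n (6 + m) n))
      where
      lemma : ∀ e f → f ≤ e → let a = e + f in 4 * a ≤ a + e + a + (a + e)
      lemma e f f≤e = ≤-balance f≤e (expanded e f)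
        where
        expanded : ∀ e f → let a = e + f in 4 * a + e ≡ a + e + a + (a + e) + f
        expanded e f = solve (e ∷ˡ f ∷ˡ []ˡ)

    -- `F (i + 5) = 5 F (i + 1) + 3 F i`.
    8a≤F : 8 * F i ≤ F (5 + i)
    8a≤F = lemma (F (1 + i)) (F i) (F-step i)
      where
      lemma : ∀ p a → a ≤ p → 8 * a ≤ p + a + p + (p + a) + (p + a + p)
      lemma p a a≤p = ≤-balance (*-monoʳ-≤ 5 a≤p) (expanded p a)
        where
        expanded : ∀ p a → 8 * a + 5 * p ≡ p + a + p + (p + a) + (p + a + p) + 5 * a
        expanded p a = solve (p ∷ˡ a ∷ˡ []ˡ)

    -- For large `k` the number `K′` may exceed `b`. But then `K ≥ F (i + 5) ≥ 8 a`, so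
    -- `K ≤ 4 a + a q` forces `4 a ≤ a q`, and `2 K′ ≤ K ≤ 2 a q`.
    near-k≥i+3 : ∀ q → 1 ≤ q → F (2 + j) ≤ 4 * F i + F i * q → F j ≤ F (2 + i) * q
    near-k≥i+3 q 1≤q K≤ with ≤-<-connex j (2 + i)
    ... | inj₁ j≤2+i = near {4 * F i} (F-mono j≤2+i) q 1≤q K≤
    ... | inj₂ 2+i<j = *-cancelˡ-≤ 2 (begin
      2 * F j              ≤⟨ 2*F≤F j ⟩
      F (2 + j)            ≤⟨ K≤ ⟩
      4 * F i + F i * q    ≤⟨ +-monoˡ-≤ _ (4a≤aq (F i) 8a≤K) ⟩
      F i * q + F i * q    ≤⟨ +-mono-≤ (*-monoˡ-≤ q a≤b) (*-monoˡ-≤ q a≤b) ⟩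
      F (2 + i) * q + F (2 + i) * q ≡⟨ cong (λ s → F (2 + i) * q + s) (+-identityʳ _) ⟨
      2 * (F (2 + i) * q)  ∎)
      where
      8a≤K : 8 * F i ≤ 4 * F i + F i * q
      8a≤K = ≤-trans 8a≤F (≤-trans (F-mono (+-monoʳ-≤ 2 2+i<j)) K≤)
      4a≤aq : ∀ a → 8 * a ≤ 4 * a + a * q → 4 * a ≤ a * q
      4a≤aq a le = +-cancelˡ-≤ (4 * a) _ _ (≤-trans (≤-reflexive (sym (*-distribʳ-+ a 4 4))) le)

    a+b≤b*4a : ∀ a b c → 1 ≤ a → a ≤ b → a + b ≤ b * (4 * a) + c * 0
    a+b≤b*4a a b c 1≤a a≤b = begin
      a + b                ≤⟨ +-monoˡ-≤ b a≤b ⟩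
      b + b                ≡⟨ solve (b ∷ˡ []ˡ) ⟩
      b * (2 * 1)          ≤⟨ *-monoʳ-≤ b (*-mono-≤ (m≤m+n 2 2) 1≤a) ⟩
      b * (4 * a)          ≤⟨ m≤m+n _ (c * 0) ⟩
      b * (4 * a) + c * 0  ∎
    w₁ : ∀ a K → 4 * a + K * 0 ≤ a * 4
    w₁ a K = ≤-reflexive (solve (a ∷ˡ K ∷ˡ []ˡ))
    w₂ : ∀ a K → 4 * a ≤ K → 4 * a + K * 0 ≤ K * 1 + a * 1
    w₂ a K 4a≤K = begin
      4 * a + K * 0  ≤⟨ +-monoˡ-≤ (K * 0) 4a≤K ⟩
      K + K * 0      ≤⟨ m≤m+n _ a ⟩
      K + K * 0 + a  ≡⟨ solve (K ∷ˡ a ∷ˡ []ˡ) ⟩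
      K * 1 + a * 1  ∎

  -- The exceptional triple 5, 13, 21

  four-5-13-21 : ∀ t → t < 5 → FourBelow 5 13 21 2 110 t
  four-5-13-21 0 _ = (0 , 0) ∷ (1 , 0) ∷ (1 , 1) ∷ (1 , 2) ∷ [] , literally-unique ,
    (0 , refl , ≤ᵇ⇒≤ _ _ _) ∷ (5 , refl , ≤ᵇ⇒≤ _ _ _) ∷ (3 , refl , ≤ᵇ⇒≤ _ _ _) ∷ (1 , refl , ≤ᵇ⇒≤ _ _ _) ∷ []
  four-5-13-21 1 _ = (0 , 0) ∷ (1 , 0) ∷ (1 , 1) ∷ (1 , 2) ∷ [] , literally-unique ,
    (1 , refl , ≤ᵇ⇒≤ _ _ _) ∷ (6 , refl , ≤ᵇ⇒≤ _ _ _) ∷ (4 , refl , ≤ᵇ⇒≤ _ _ _) ∷ (2 , refl , ≤ᵇ⇒≤ _ _ _) ∷ []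
  four-5-13-21 2 _ = (0 , 0) ∷ (0 , 1) ∷ (1 , 2) ∷ (1 , 3) ∷ [] , literally-unique ,
    (2 , refl , ≤ᵇ⇒≤ _ _ _) ∷ (0 , refl , ≤ᵇ⇒≤ _ _ _) ∷ (3 , refl , ≤ᵇ⇒≤ _ _ _) ∷ (1 , refl , ≤ᵇ⇒≤ _ _ _) ∷ []
  four-5-13-21 3 _ = (0 , 0) ∷ (0 , 1) ∷ (1 , 2) ∷ (1 , 3) ∷ [] , literally-unique ,
    (3 , refl , ≤ᵇ⇒≤ _ _ _) ∷ (1 , refl , ≤ᵇ⇒≤ _ _ _) ∷ (4 , refl , ≤ᵇ⇒≤ _ _ _) ∷ (2 , refl , ≤ᵇ⇒≤ _ _ _) ∷ []
  four-5-13-21 4 _ = (0 , 0) ∷ (0 , 1) ∷ (0 , 2) ∷ (1 , 4) ∷ [] , literally-unique ,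
    (4 , refl , ≤ᵇ⇒≤ _ _ _) ∷ (2 , refl , ≤ᵇ⇒≤ _ _ _) ∷ (0 , refl , ≤ᵇ⇒≤ _ _ _) ∷ (1 , refl , ≤ᵇ⇒≤ _ _ _) ∷ []
  four-5-13-21 (suc (suc (suc (suc (suc _))))) (s≤s (s≤s (s≤s (s≤s (s≤s ())))))

  -- The general choice for `k = i − 2` would be `Y = F 0 = 0`, which belongs to no pair. The same
  -- level `2 a = 10` is reached with `Y = K = 2` and `Z = 4`, and `110 = 13 * 2 + 21 * 4`.
  g₃-5-13-21 : IsFrobeniusNumber 3 (F 5 ∷ F 7 ∷ F 8 ∷ []) (+ F 7 ℤ.+ + 4 ℤ.* + F 8 ℤ.- + F 5)
  g₃-5-13-21 = isFrobeniusNumber 2 4 table-3 {F 7} {F 8} {+ F 7 ℤ.+ + 4 ℤ.* + F 8 ℤ.- + F 5}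
    refl refl refl ≤-refl (near {2} (≤ᵇ⇒≤ 1 13 _)) (≤ᵇ⇒≤ 18 110 _)
    (complete-3 {10} (≤ᵇ⇒≤ 10 10 _) (≤ᵇ⇒≤ 10 11 _)) four-5-13-21
    where
    open FibonacciTriple 5 1 (s≤s z≤n) (s≤s z≤n)

  -- Small `k`: at least three multiples of `F k` below `F i`

  module _ {i j S ρ : ℕ} (1≤i : 1 ≤ i) (1≤j : 1 ≤ j) (1≤S : 1 ≤ S) (S≤K : S ≤ F (2 + j))
    (a≡ : F i ≡ S + (3 + ρ) * F (2 + j)) where
    open FibonacciTriple i j 1≤i 1≤j
    open ≤-Reasoning

    private
      K≤a : F (2 + j) ≤ F i
      K≤a = begin
        F (2 + j)                  ≤⟨ m≤n*m (F (2 + j)) (3 + ρ) ⟩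
        (3 + ρ) * F (2 + j)        ≤⟨ m≤n+m _ S ⟩
        S + (3 + ρ) * F (2 + j)    ≡⟨ a≡ ⟨
        F i                        ∎

      K′≤b : F j ≤ F (2 + i)
      K′≤b = ≤-trans (F-step j) (≤-trans (F-step (1 + j)) (≤-trans K≤a a≤b))

      complete : ∀ {w} → w ≤ S + (6 + ρ) * F (2 + j) → Complete table-3 w
      complete w≤ = complete-3
        (≤-trans w≤ (≤-trans (w₁ S (F (2 + j))) (≤-reflexive (cong (_* 2) (sym a≡)))))
        (≤-trans w≤ (≤-trans (w₂ S (F (2 + j))) (≤-reflexive (cong (λ s → F (2 + j) * 3 + s * 1) (sym a≡)))))
        where
        -- The assumption `r ≥ 3` enters through `6 + ρ ≤ 2 (3 + ρ)`: no pair lies two levels down.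
        w₁ : ∀ S K → S + (6 + ρ) * K ≤ (S + (3 + ρ) * K) * 2
        w₁ S K = ≤-slack (S + ρ * K) (solve (S ∷ˡ K ∷ˡ ρ ∷ˡ []ˡ))
        w₂ : ∀ S K → S + (6 + ρ) * K ≤ K * 3 + (S + (3 + ρ) * K) * 1
        w₂ S K = ≤-reflexive (solve (S ∷ˡ K ∷ˡ ρ ∷ˡ []ˡ))

      relation : F (2 + j + i) + F i * F j ≡ F (2 + i) * F (2 + j)
      relation = F-relation i j

      -- The two candidates for the bound differ by `b K − b S − c = a K′ − b S`, whose sign is the
      -- case distinction of the theorem.
      K-below : F i * F j ≤ F (2 + i) * S →
                F (2 + i) * F (2 + j) + F (2 + j + i) * (5 + ρ) ≤ F (2 + i) * S + F (2 + j + i) * (6 + ρ)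
      K-below = lemma (F i) (F (2 + i)) (F (2 + j + i)) (F (2 + j)) (F j) relation
        where
        lemma : ∀ a b c K K′ → c + a * K′ ≡ b * K → a * K′ ≤ b * S → b * K + c * (5 + ρ) ≤ b * S + c * (6 + ρ)
        lemma a b c K K′ rel le = begin
          b * K + c * (5 + ρ)             ≡⟨ cong (_+ c * (5 + ρ)) rel ⟨
          c + a * K′ + c * (5 + ρ)        ≤⟨ +-monoˡ-≤ _ (+-monoʳ-≤ c le) ⟩
          c + b * S + c * (5 + ρ)         ≡⟨ solve (b ∷ˡ c ∷ˡ S ∷ˡ ρ ∷ˡ []ˡ) ⟩
          b * S + c * (6 + ρ)             ∎

      S-below : F (2 + i) * S ≤ F i * F j →
                F (2 + i) * S + F (2 + j + i) * (6 + ρ) ≤ F (2 + i) * F (2 + j) + F (2 + j + i) * (5 + ρ)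
      S-below = lemma (F i) (F (2 + i)) (F (2 + j + i)) (F (2 + j)) (F j) relation
        where
        lemma : ∀ a b c K K′ → c + a * K′ ≡ b * K → b * S ≤ a * K′ → b * S + c * (6 + ρ) ≤ b * K + c * (5 + ρ)
        lemma a b c K K′ rel le = begin
          b * S + c * (6 + ρ)             ≡⟨ solve (b ∷ˡ c ∷ˡ S ∷ˡ ρ ∷ˡ []ˡ) ⟩
          c + b * S + c * (5 + ρ)         ≤⟨ +-monoˡ-≤ _ (+-monoʳ-≤ c le) ⟩
          c + a * K′ + c * (5 + ρ)        ≡⟨ cong (_+ c * (5 + ρ)) rel ⟩
          b * K + c * (5 + ρ)             ∎

      instance
        K≢0 : NonZero (F (2 + j))
        K≢0 = F-nonZero {0} {2 + j} z<s

    g₃-a≡S+rK-large : ∀ {b c G} → b ≡ F (2 + i) → c ≡ F (2 + j + i) →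
              G ≡ (+ S ℤ.- + 1) ℤ.* + b ℤ.+ + (6 + ρ) ℤ.* + c ℤ.- + F i →
              F i * F j ≤ F (2 + i) * S → IsFrobeniusNumber 3 (F i ∷ b ∷ c ∷ []) G
    g₃-a≡S+rK-large b≡ c≡ G≡ large = isFrobeniusNumber S (6 + ρ) table-3 b≡ c≡ G≡ S≤K (near {S} K′≤b)
      (a+b≤ 1≤S (s≤s z≤n)) (complete (≤-reflexive (cong (λ s → S + s) (*-comm (F (2 + j)) (6 + ρ)))))
      (four-r≥3 S ρ (F (2 + j)) {F i} {F (2 + i)} {F (2 + j + i)} S≤K a≡ (bK≤2c a≤b (2*F≤F j))
        ≤-refl (K-below large))

    g₃-a≡S+rK-small : ∀ {b c G} → b ≡ F (2 + i) → c ≡ F (2 + j + i) →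
              G ≡ (+ F (2 + j) ℤ.- + 1) ℤ.* + b ℤ.+ + (5 + ρ) ℤ.* + c ℤ.- + F i →
              F (2 + i) * S ≤ F i * F j → IsFrobeniusNumber 3 (F i ∷ b ∷ c ∷ []) G
    g₃-a≡S+rK-small b≡ c≡ G≡ small = isFrobeniusNumber (F (2 + j)) (5 + ρ) table-3 b≡ c≡ G≡ ≤-refl
      (near {F (2 + j)} K′≤b) (a+b≤ (F-positive {2 + j} (s≤s z≤n)) (s≤s z≤n))
      (complete (≤-trans (≤-reflexive (w≡ (F (2 + j)))) (m≤n+m _ S)))
      (four-r≥3 S ρ (F (2 + j)) {F i} {F (2 + i)} {F (2 + j + i)} S≤K a≡ (bK≤2c a≤b (2*F≤F j))
        (S-below small) ≤-refl)
      where
      w≡ : ∀ K → K + K * (5 + ρ) ≡ (6 + ρ) * K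
      w≡ K = solve (K ∷ˡ ρ ∷ˡ []ˡ)

  module _ (m j : ℕ) (3≤k : 3 ≤ 2 + j) where
    private
      i k r : ℕ
      i = 3 + m
      k = 2 + j
      instance
        Fk≢0 : NonZero (F k)
        Fk≢0 = F-nonZero {2} {2 + j} 3≤k
      r = (F i ∸ 1) / F k

    open ≤-Reasoning

    -- Rests on `F i ≤ 3 F (i − 2)` and, for `i ≥ 6`, on `3 F (i − 3) < F i`.
    r≥3⇔ : r ≥ 3 ⇔ k ≤ i ∸ 3
    r≥3⇔ = mk⇔ to from
      where
      lemma : ∀ p q → q ≤ p → p + q + p ≤ 3 * p
      lemma p q q≤p = ≤-balance q≤p (solve (p ∷ˡ q ∷ˡ []ˡ))
      to : r ≥ 3 → k ≤ m
      to r≥3 = ≮⇒≥ λ m<k → <-irrefl refl (begin-strict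
        F i ∸ 1               <⟨ ∸-monoʳ-< (s≤s z≤n) (F-positive {i} (s≤s z≤n)) ⟩
        F i                   ≤⟨ lemma (F (1 + m)) (F m) (F-step m) ⟩
        3 * F (1 + m)         ≤⟨ *-mono-≤ r≥3 (F-mono m<k) ⟩
        r * F k               ≤⟨ m/n*n≤m (F i ∸ 1) (F k) ⟩
        F i ∸ 1               ∎)
      3F<F : ∀ {n} → 3 ≤ n → 3 * F n < F (3 + n)
      3F<F {suc (suc n)} (s≤s (s≤s 1≤n)) = expanded (F (1 + n)) (F n) (F-positive {1 + n} (s≤s z≤n))
        where
        expanded : ∀ p q → 1 ≤ p → 3 * (p + q) < p + q + p + (p + q) + (p + q + p)
        expanded p q 1≤p = ≤-balance (≤-trans 1≤p (m≤n*m p 2)) (lemma₂ p q)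
          where
          lemma₂ : ∀ p q → 1 + 3 * (p + q) + 2 * p ≡ p + q + p + (p + q) + (p + q + p) + 1
          lemma₂ p q = solve (p ∷ˡ q ∷ˡ []ˡ)
      from : k ≤ m → r ≥ 3
      from k≤m = begin
        3                     ≡⟨ m*n/n≡m 3 (F k) ⟨
        3 * F k / F k         ≤⟨ /-monoˡ-≤ (F k) (<⇒≤pred
                                   (≤-<-trans (*-monoʳ-≤ 3 (F-mono k≤m)) (3F<F (≤-trans 3≤k k≤m)))) ⟩
        r                     ∎

    module _ (r≥3 : r ≥ 3) where
      private
        S ρ : ℕ
        -- Dividing `F i − 1` rather than `F i` gives `F i = S + r F k` with `1 ≤ S ≤ F k`, so that
        -- `S` can serve as `Y`.
        S = suc ((F i ∸ 1) % F k)
        ρ = r ∸ 3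

        r≡ : 3 + ρ ≡ r
        r≡ = m+[n∸m]≡n r≥3

        a≡ : F i ≡ S + r * F k
        a≡ = trans (sym (suc-pred (F i) {{F-nonZero {0} {i} z<s}}))
                   (cong suc (m≡m%n+[m/n]*n (F i ∸ 1) (F k)))

        S≡ : + F i ℤ.- + r ℤ.* + F k ≡ + S
        S≡ = trans (cong₂ ℤ._-_ (cong +_ a≡) (sym (ℤ.pos-* r (F k)))) (cancel (+ S) (+ (r * F k)))
          where
          cancel : ∀ s t → s ℤ.+ t ℤ.- t ≡ s
          cancel = ℤSolver.solve-∀

        b≡ : F (i + 2) ≡ F (2 + i)
        b≡ = cong F (+-comm i 2)
        c≡ : F (i + k) ≡ F (2 + j + i)
        c≡ = cong F (+-comm i k)

        1≤j : 1 ≤ j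
        1≤j = s≤s⁻¹ (s≤s⁻¹ 3≤k)

        a≡′ : F i ≡ S + (3 + ρ) * F k
        a≡′ = trans a≡ (cong (λ s → S + s * F k) (sym r≡))

        lhs≡ : (+ F i ℤ.- + r ℤ.* + F k) ℤ.* + F (i + 2) ≡ + (F (2 + i) * S)
        lhs≡ = trans (cong₂ ℤ._*_ S≡ (cong +_ b≡))
          (trans (ℤ.*-comm (+ S) (+ F (2 + i))) (sym (ℤ.pos-* (F (2 + i)) S)))

        rhs≡ : + F (k ∸ 2) ℤ.* + F i ≡ + (F i * F j)
        rhs≡ = trans (ℤ.*-comm (+ F j) (+ F i)) (sym (ℤ.pos-* (F i) (F j)))

      g₃-r≥3-≥ : (+ F i ℤ.- + r ℤ.* + F k) ℤ.* + F (i + 2) ℤ.≥ + F (k ∸ 2) ℤ.* + F i →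
        IsFrobeniusNumber 3 (F i ∷ F (i + 2) ∷ F (i + k) ∷ [])
          ((+ F i ℤ.- + r ℤ.* + F k ℤ.- + 1) ℤ.* + F (i + 2) ℤ.+ (+ r ℤ.+ + 3) ℤ.* + F (i + k) ℤ.- + F i)
      g₃-r≥3-≥ le = g₃-a≡S+rK-large {i} {j} {S} {ρ} (s≤s z≤n) 1≤j (s≤s z≤n) (m%n<n (F i ∸ 1) (F k)) a≡′ b≡ c≡
        (cong₂ (λ s t → (s ℤ.- + 1) ℤ.* + F (i + 2) ℤ.+ + t ℤ.* + F (i + k) ℤ.- + F i) S≡
          (trans (+-comm r 3) (cong (λ s → 3 + s) (sym r≡))))
        (ℤ.drop‿+≤+ (subst₂ ℤ._≤_ rhs≡ lhs≡ le))

      g₃-r≥3-< : (+ F i ℤ.- + r ℤ.* + F k) ℤ.* + F (i + 2) ℤ.< + F (k ∸ 2) ℤ.* + F i →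
        IsFrobeniusNumber 3 (F i ∷ F (i + 2) ∷ F (i + k) ∷ [])
          ((+ F k ℤ.- + 1) ℤ.* + F (i + 2) ℤ.+ (+ r ℤ.+ + 2) ℤ.* + F (i + k) ℤ.- + F i)
      g₃-r≥3-< lt = g₃-a≡S+rK-small {i} {j} {S} {ρ} (s≤s z≤n) 1≤j (s≤s z≤n) (m%n<n (F i ∸ 1) (F k)) a≡′ b≡ c≡
        (cong (λ t → (+ F k ℤ.- + 1) ℤ.* + F (i + 2) ℤ.+ + t ℤ.* + F (i + k) ℤ.- + F i)
          (trans (+-comm r 2) (cong (λ s → 2 + s) (sym r≡))))
        (<⇒≤ (ℤ.drop‿+<+ (subst₂ ℤ._<_ lhs≡ rhs≡ lt)))

open ThreeFibonacciGenerators
open import Data.Nat as ℕ using (ℕ; suc; s≤s; z≤n)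
open import Data.Integer using (+_; _+_; _-_; _*_; _≥_; _<_)
open import Data.Product using (_×_; _,_)
open import Data.Vec using ([]; _∷_)
open import Function.Bundles using (_⇔_)
open import Relation.Binary.PropositionalEquality using (_≡_; refl)

theorem4 : (i k : ℕ) → 3 ℕ.≤ i → (3≤k : 3 ℕ.≤ k) →
  -- (a)
  (k ℕ.≥ i ℕ.+ 3 →
    IsFrobeniusNumber 3 (F i ∷ F (i ℕ.+ 2) ∷ F (i ℕ.+ k) ∷ [])
      ((+ 4 * + F i - + 1) * + F (i ℕ.+ 2) - + F i))
  -- (b)
  × IsFrobeniusNumber 3 (F i ∷ F (i ℕ.+ 2) ∷ F (2 ℕ.* i ℕ.+ 2) ∷ [])
      ((+ F i - + 1) * + F (i ℕ.+ 2) + + F (2 ℕ.* i ℕ.+ 2) - + F i)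
  -- (c)
  × IsFrobeniusNumber 3 (F i ∷ F (i ℕ.+ 2) ∷ F (2 ℕ.* i ℕ.+ 1) ∷ [])
      ((+ F i + + F (i ℕ.∸ 2) - + 1) * + F (i ℕ.+ 2) + + F (2 ℕ.* i ℕ.+ 1) - + F i)
  -- (d)
  × IsFrobeniusNumber 3 (F i ∷ F (i ℕ.+ 2) ∷ F (2 ℕ.* i) ∷ [])
      ((+ F i - + 1) * + F (i ℕ.+ 2) + + 2 * + F (2 ℕ.* i) - + F i)
  -- (e)
  × (i ℕ.≥ 4 →
    IsFrobeniusNumber 3 (F i ∷ F (i ℕ.+ 2) ∷ F (2 ℕ.* i ℕ.∸ 1) ∷ [])
      ((+ F (i ℕ.∸ 2) - + 1) * + F (i ℕ.+ 2) + + 3 * + F (2 ℕ.* i ℕ.∸ 1) - + F i))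
  -- (f)
  × (i ℕ.≥ 6 →
    IsFrobeniusNumber 3 (F i ∷ F (i ℕ.+ 2) ∷ F (2 ℕ.* i ℕ.∸ 2) ∷ [])
      ((+ F (i ℕ.∸ 5) - + 1) * + F (i ℕ.+ 2) + + 5 * + F (2 ℕ.* i ℕ.∸ 2) - + F i))
  × IsFrobeniusNumber 3 (F 5 ∷ F 7 ∷ F 8 ∷ []) (+ F 7 + + 4 * + F 8 - + F 5)
  × (+ F 7 + + 4 * + F 8 - + F 5 ≡ + 92)
  -- (g)
  × (let r = ℕ._/_ (F i ℕ.∸ 1) (F k) {{F-nonZero 3≤k}} in
    (r ℕ.≥ 3 ⇔ k ℕ.≤ i ℕ.∸ 3)
    × (r ℕ.≥ 3 →
      ((+ F i - + r * + F k) * + F (i ℕ.+ 2) ≥ + F (k ℕ.∸ 2) * + F i →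
        IsFrobeniusNumber 3 (F i ∷ F (i ℕ.+ 2) ∷ F (i ℕ.+ k) ∷ [])
          ((+ F i - + r * + F k - + 1) * + F (i ℕ.+ 2) + (+ r + + 3) * + F (i ℕ.+ k) - + F i))
      × ((+ F i - + r * + F k) * + F (i ℕ.+ 2) < + F (k ℕ.∸ 2) * + F i →
        IsFrobeniusNumber 3 (F i ∷ F (i ℕ.+ 2) ∷ F (i ℕ.+ k) ∷ [])
          ((+ F k - + 1) * + F (i ℕ.+ 2) + (+ r + + 2) * + F (i ℕ.+ k) - + F i))))
theorem4 (suc (suc (suc m))) (suc (suc j)) (s≤s (s≤s (s≤s z≤n))) 3≤k@(s≤s (s≤s _)) =
  g₃-k≥i+3 m , g₃-k=i+2 m , g₃-k=i+1 m , g₃-k=i m , g₃-k=i∸1 , g₃-k=i∸2 , g₃-5-13-21 , refl ,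
  r≥3⇔ m j 3≤k , λ r≥3 → g₃-r≥3-≥ m j 3≤k r≥3 , g₃-r≥3-< m j 3≤k r≥3
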